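{- For every simple digraph $H$ there is a constant $c_H$ (depending only on $H$) such that for every positive integer $k$ and every tournament $T$, at least one of the following holds: (i) $T$ contains $k$ pairwise arc-disjoint immersion copies of $H$; or (ii) there is a set $F$ of at most $c_H\cdot k^3$ arcs of $T$ that intersects all immersion copies of $H$ in $T$ (equivalently, $T-F$ does not contain $H$ as an immersion). In other words, $H$ has the Erdős–Pósa property for immersions in tournaments with bounding function $f(k)\in\mathcal{O}_H(k^3)$.
   Context: All digraphs are finite and simple (no loops, no two arcs with the same head and tail). A tournament is a simple digraph in which every pair of distinct vertices is joined by exactly one arc. A digraph $\widehat H$ is an immersion copy (immersion model) of a digraph $H$ if there is a mapping $\phi$ sending the vertices of $H$ to pairwise distinct vertices of $\widehat H$ and each arc $(u,v)$ of $H$ to a directed path in $\widehat H$ from $\phi(u)$ to $\phi(v)$, such that each arc of $\widehat H$ belongs to exactly one of these paths. A digraph $G$ contains $H$ as an immersion if some subgraph of $G$ is an immersion copy of $H$. For a set $F$ of arcs, $T-F$ denotes $T$ with the arcs of $F$ removed. -}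

module Defs where

open import Data.Nat using (ℕ; zero; suc; _*_; _^_; _≤_)
open import Data.Fin using (Fin)
open import Data.Bool using (Bool; true; false)
open import Data.Product using (_×_; _,_; Σ; ∃)
open import Data.Sum using (_⊎_)
open import Data.List using (List; []; _∷_; length)
open import Data.List.Membership.Propositional using (_∈_; _∉_)
open import Data.List.Relation.Unary.All using (All)
open import Data.List.Relation.Unary.Unique.Propositional using (Unique)
open import Relation.Binary.PropositionalEquality using (_≡_; _≢_)
open import Relation.Nullary using (¬_)

-- A (finite) digraph on vertex set Fin n, given by its adjacency function.
-- Being a relation, it has at most one arc with a given tail and head.
Digraph : ℕ → Set
Digraph n = Fin n → Fin n → Bool

Arc : ∀ {n} → Digraph n → Fin n → Fin n → Set
Arc G x y = G x y ≡ true

Simple : ∀ {n} → Digraph n → Set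
Simple G = ∀ x → ¬ Arc G x x

Tournament : ∀ {n} → Digraph n → Set
Tournament G = Simple G × (∀ x y → x ≢ y → (Arc G x y ⊎ Arc G y x) × ¬ (Arc G x y × Arc G y x))

data Walk {n} (G : Digraph n) : Fin n → Fin n → Set where
  stop : ∀ {x} → Walk G x x
  step : ∀ {x y z} → Arc G x y → Walk G y z → Walk G x z

vertices : ∀ {n} {G : Digraph n} {x y} → Walk G x y → List (Fin n)
vertices {x = x} stop = x ∷ []
vertices {x = x} (step _ w) = x ∷ vertices w

arcs : ∀ {n} {G : Digraph n} {x y} → Walk G x y → List (Fin n × Fin n)
arcs stop = []
arcs {x = x} (step {y = y} _ w) = (x , y) ∷ arcs w

IsPath : ∀ {n} {G : Digraph n} {x y} → Walk G x y → Set
IsPath w = Unique (vertices w)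

-- An immersion copy of H contained in G: injective vertex map φ and, for each arc
-- (u , v) of H, a directed path in G from φ u to φ v, such that the paths of
-- distinct arcs of H are arc-disjoint (their union is then a subgraph of G which
-- is an immersion copy of H, each of its arcs lying in exactly one path).
record Immersion {n h} (G : Digraph n) (H : Digraph h) : Set where
  field
    φ : Fin h → Fin n
    φ-inj : ∀ u v → φ u ≡ φ v → u ≡ v
    route : ∀ u v → Arc H u v → Walk G (φ u) (φ v)
    route-path : ∀ u v (p : Arc H u v) → IsPath (route u v p)
    route-disjoint : ∀ u v (p : Arc H u v) u' v' (p' : Arc H u' v') →
      (u , v) ≢ (u' , v') → ∀ e → e ∈ arcs (route u v p) → e ∉ arcs (route u' v' p')

open Immersion public

UsesArc : ∀ {n h} {G : Digraph n} {H : Digraph h} → Immersion G H → Fin n × Fin n → Set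
UsesArc {H = H} M e = Σ _ λ u → Σ _ λ v → Σ (Arc H u v) λ p → e ∈ arcs (route M u v p)

DisjointImmersions : ∀ {n h} → ℕ → Digraph n → Digraph h → Set
DisjointImmersions {n} {h} k G H =
  Σ (Fin k → Immersion G H) λ M →
    ∀ i j → i ≢ j → ∀ e → UsesArc (M i) e → ¬ UsesArc (M j) e

SmallHittingSet : ∀ {n h} → ℕ → Digraph n → Digraph h → Set
SmallHittingSet {n} b G H =
  Σ (List (Fin n × Fin n)) λ F →
    Unique F × All (λ e → Arc G (Data.Product.proj₁ e) (Data.Product.proj₂ e)) F × length F ≤ b ×
    (∀ (M : Immersion G H) → Σ _ λ e → e ∈ F × UsesArc M e)

{-# OPTIONS --safe #-}

-- Order the vertices by decreasing outdegree.  If some cut of this ordering is crossed by more than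
-- C k² backward arcs, then there are |H| vertices any two of which are joined by short paths even
-- after O(k) vertices are forbidden as interior ones, and k arc-disjoint copies are routed greedily.
-- Otherwise scan the ordering for minimal intervals containing immersions of the induced subgraphs
-- H[S] with |S| ≥ 2, following all sequences of at most |H| sets S and taking O(k) intervals for
-- each entry.  Delete the backward arcs across the O(k) cuts next to the ends of these intervals.
-- A copy surviving the deletion splits into pieces lying in the blocks between the cuts, with all
-- connections going forward; minimality then forces O(k) disjoint intervals for each piece,
-- in the order of the pieces (a one-vertex piece fits into any interval, so it borrows those of the
-- nearest larger piece).  Since only O(k²) backward arcs run between different pieces, k disjoint
-- choices of one interval per piece have no backward arc and hence form copies of H.
module Submission where

open import Defs
open import Axiom.UniquenessOfIdentityProofs.WithK using (uip)
open import Data.Bool using (Bool; true; false; _∧_; not)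
import Data.Bool.Properties as Boolₚ
open import Data.Empty using (⊥-elim)
open import Data.Fin using (Fin; zero; suc; toℕ; fromℕ<; inject≤; combine; remQuot; punchOut)
import Data.Fin.Properties as Finₚ
open import Data.List using (List; []; _∷_; length; map; _++_; filter; allFin; concatMap; cartesianProduct; lookup)
open import Data.List.Membership.Propositional using (_∈_; _∉_; find; lose)
open import Data.List.Membership.Propositional.Properties using (∈-filter⁺; ∈-filter⁻; ∈-allFin; ∈-lookup; ∈-map⁺; ∈-++⁺ˡ; ∈-++⁺ʳ; ∈-++⁻; ∈-concatMap⁺; ∈-cartesianProduct⁺)
import Data.List.Membership.Setoid.Properties as MemSetoid
open import Data.List.Properties using (length-map; length-++; length-tabulate; length-filter)
open import Data.List.Relation.Unary.All using (All; []; _∷_)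
import Data.List.Relation.Unary.All as All
import Data.List.Relation.Unary.All.Properties as Allₚ
import Data.List.Relation.Unary.AllPairs as AP
open import Data.List.Relation.Unary.Any using (here; there; index)
import Data.List.Relation.Unary.Any as Any
open import Data.List.Relation.Unary.Unique.Propositional using (Unique)
import Data.List.Relation.Unary.Unique.Propositional.Properties as Uniqueₚ
open import Data.Nat using (ℕ; zero; suc; _+_; _*_; _∸_; _^_; _⊔_; _≤_; _<_; _≤?_; _<?_; z≤n; s≤s)
open import Data.Nat.ListAction using (sum)
open import Data.Nat.Properties
open import Data.Nat.Tactic.RingSolver using (solve-∀)
open import Data.Product using (_×_; _,_; Σ; proj₁; proj₂)
open import Data.Product.Properties using (≡-dec)
open import Data.Sum using (_⊎_; inj₁; inj₂)
import Data.Sum as Sum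
import Data.Vec.Functional as VF
open import Function using (_∘_; id)
open import Relation.Binary.Definitions using (tri<; tri≈; tri>)
open import Relation.Binary.PropositionalEquality
open import Relation.Nullary using (¬_; Dec; yes; no; does; contradiction)
open import Relation.Nullary.Decidable using (dec-true; dec-false; _×-dec_; _→-dec_; ¬?; map′)

-- The exponent 3 is the product of O(k) cuts and O(k²) backward arcs across each. The bound k² per
-- cut is a product of two linear ones: many arcs across a cut have many distinct heads or many
-- distinct tails, and a linear number of either is enough for the degree argument. The obstacle is
-- the order of choices: arcs are deleted before the surviving copy, hence the sequence of its
-- pieces, is known. Therefore the scan branches over all sequences of sets, and their number
-- depends on `H` only. To choose one interval per piece, the intervals are numbered and a choice is
-- a line: number `i + c * r` at level `r`. A backward arc between different levels fixes two cells,
-- and two distinct lines share at most one, so each arc spoils at most one line. With `2k` offsets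
-- per slope and a number `C` of slopes for which `C * k` exceeds the number of these arcs, some
-- slope keeps `k` unspoiled lines, and lines of equal slope are disjoint. All alternatives are
-- decided by finite search, hence the decision procedures for walks, systems and pieces.

private variable
  X Y : Set
  n h : ℕ

does-true : {P : Set} (d : Dec P) → does d ≡ true → P
does-true (yes p) _ = p

does-not : {P : Set} (d : Dec P) → not (does d) ≡ true → ¬ P
does-not (no ¬p) _ = ¬p

∧-intro : ∀ {a b} → a ≡ true → b ≡ true → a ∧ b ≡ true
∧-intro refl refl = refl

∧-fst : ∀ {a b} → a ∧ b ≡ true → a ≡ true
∧-fst {true} _ = refl

∧-snd : ∀ {a b} → a ∧ b ≡ true → b ≡ true
∧-snd {true} p = p

-- Finite sums and cardinalities

𝟙 : Bool → ℕ
𝟙 true  = 1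
𝟙 false = 0

∑ : List X → (X → ℕ) → ℕ
∑ xs f = sum (map f xs)

∑-mono : ∀ (xs : List X) {f g : X → ℕ} → (∀ x → f x ≤ g x) → ∑ xs f ≤ ∑ xs g
∑-mono []       le = z≤n
∑-mono (x ∷ xs) le = +-mono-≤ (le x) (∑-mono xs le)

∑-+ : ∀ (xs : List X) (f g : X → ℕ) → ∑ xs (λ x → f x + g x) ≡ ∑ xs f + ∑ xs g
∑-+ []       f g = refl
∑-+ (x ∷ xs) f g rewrite ∑-+ xs f g = interchange (f x) (g x) (∑ xs f) (∑ xs g)
  where
  interchange : ∀ a b c d → a + b + (c + d) ≡ a + c + (b + d)
  interchange = solve-∀

∑-+₃ : ∀ (xs : List X) (f g h : X → ℕ) →
  ∑ xs (λ x → f x + g x + h x) ≡ ∑ xs f + ∑ xs g + ∑ xs h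
∑-+₃ xs f g h = trans (∑-+ xs (λ x → f x + g x) h) (cong (_+ ∑ xs h) (∑-+ xs f g))

∑-*ˡ : ∀ (xs : List X) c (f : X → ℕ) → ∑ xs (λ x → c * f x) ≡ c * ∑ xs f
∑-*ˡ []       c f = sym (*-zeroʳ c)
∑-*ˡ (x ∷ xs) c f rewrite ∑-*ˡ xs c f = sym (*-distribˡ-+ c (f x) (∑ xs f))

∑-one : ∀ (xs : List X) → ∑ xs (λ _ → 1) ≡ length xs
∑-one []       = refl
∑-one (x ∷ xs) = cong suc (∑-one xs)

∑-zero : ∀ (xs : List X) → ∑ xs (λ _ → 0) ≡ 0
∑-zero []       = refl
∑-zero (x ∷ xs) = ∑-zero xs

∑-swap : ∀ (xs : List X) (ys : List Y) (f : X → Y → ℕ) →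
  ∑ xs (λ x → ∑ ys (f x)) ≡ ∑ ys (λ y → ∑ xs (λ x → f x y))
∑-swap []       ys f = sym (∑-zero ys)
∑-swap (x ∷ xs) ys f rewrite ∑-swap xs ys f = sym (∑-+ ys (f x) (λ y → ∑ xs (λ x → f x y)))

# : (Fin n → Bool) → ℕ
# p = ∑ (allFin _) (𝟙 ∘ p)

elems : (Fin n → Bool) → List (Fin n)
elems p = filter (λ x → p x Boolₚ.≟ true) (allFin _)

length-elems : (p : Fin n → Bool) → length (elems p) ≡ # p
length-elems {n} p = go (allFin n)
  where
  go : ∀ xs → length (filter (λ x → p x Boolₚ.≟ true) xs) ≡ ∑ xs (𝟙 ∘ p)
  go [] = refl
  go (x ∷ xs) with p x
  ... | true  = cong suc (go xs)
  ... | false = go xs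

elems-unique : (p : Fin n → Bool) → Unique (elems p)
elems-unique p = Uniqueₚ.filter⁺ (λ x → p x Boolₚ.≟ true) (Uniqueₚ.allFin⁺ _)

∈-elems⁺ : (p : Fin n → Bool) {x : Fin n} → p x ≡ true → x ∈ elems p
∈-elems⁺ p px = ∈-filter⁺ (λ x → p x Boolₚ.≟ true) (∈-allFin _) px

∈-elems⁻ : (p : Fin n → Bool) {x : Fin n} → x ∈ elems p → p x ≡ true
∈-elems⁻ p x∈ = proj₂ (∈-filter⁻ (λ x → p x Boolₚ.≟ true) {xs = allFin _} x∈)

unique-lookup-injective : {xs : List X} → Unique xs → ∀ i j → lookup xs i ≡ lookup xs j → i ≡ j
unique-lookup-injective (_ AP.∷ _) zero    zero    eq = refl
unique-lookup-injective (h AP.∷ _) zero    (suc j) eq = contradiction eq (All.lookup h (∈-lookup j))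
unique-lookup-injective (h AP.∷ _) (suc i) zero    eq = contradiction (sym eq) (All.lookup h (∈-lookup i))
unique-lookup-injective (_ AP.∷ u) (suc i) (suc j) eq = cong suc (unique-lookup-injective u i j eq)

unique-⊆-length : {xs ys : List X} → Unique xs → (∀ {x} → x ∈ xs → x ∈ ys) → length xs ≤ length ys
unique-⊆-length {xs = xs} u sub = Finₚ.injective⇒≤ {f = λ i → index (sub (∈-lookup {xs = xs} i))}
  (λ {i} {j} eq → unique-lookup-injective u i j
     (MemSetoid.index-injective (setoid _) (sub (∈-lookup i)) (sub (∈-lookup j)) eq))

𝟙-mono : ∀ {a b} → (a ≡ true → b ≡ true) → 𝟙 a ≤ 𝟙 b
𝟙-mono {false}         _   = z≤n
𝟙-mono {true}  {true}  _   = ≤-refl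
𝟙-mono {true}  {false} imp = contradiction (imp refl) λ ()

#-mono : ∀ {p q : Fin n → Bool} → (∀ x → p x ≡ true → q x ≡ true) → # p ≤ # q
#-mono imp = ∑-mono (allFin _) (λ x → 𝟙-mono (imp x))

#-list : (L : List (Fin n)) (p : Fin n → Bool) → (∀ x → p x ≡ true → x ∈ L) → # p ≤ length L
#-list L p sub = ≤-trans (≤-reflexive (sym (length-elems p)))
  (unique-⊆-length (elems-unique p) (λ x∈ → sub _ (∈-elems⁻ p x∈)))

∑-allFin-one : ∑ (allFin n) (λ _ → 1) ≡ n
∑-allFin-one {n} = trans (∑-one (allFin n)) (length-tabulate {n = n} id)

#-all : # {n} (λ _ → true) ≡ n
#-all = ∑-allFin-one

#-pos : ∀ (p : Fin n → Bool) {x} → p x ≡ true → 1 ≤ # p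
#-pos p px = subst (1 ≤_) (length-elems p) (nonempty (∈-elems⁺ p px))
  where
  nonempty : ∀ {x : Fin _} {xs} → x ∈ xs → 1 ≤ length xs
  nonempty (here _)  = s≤s z≤n
  nonempty (there _) = s≤s z≤n

#-self : ∀ (x : Fin n) → # (λ y → does (y Finₚ.≟ x)) ≡ 1
#-self x = ≤-antisym
  (#-list (x ∷ []) _ (λ y p → here (does-true (y Finₚ.≟ x) p)))
  (#-pos (λ y → does (y Finₚ.≟ x)) {x} (dec-true (x Finₚ.≟ x) refl))

#-mono-< : ∀ {p q : Fin n → Bool} x₀ → (∀ x → p x ≡ true → q x ≡ true) →
  p x₀ ≡ false → q x₀ ≡ true → # p < # q
#-mono-< {n} {p} {q} x₀ imp px₀ qx₀ = begin
  suc (# p)                                        ≡⟨ cong (_+ # p) (#-self x₀) ⟨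
  # self + # p                                     ≡⟨ ∑-+ (allFin n) _ _ ⟨
  ∑ (allFin n) (λ x → 𝟙 (self x) + 𝟙 (p x))        ≤⟨ ∑-mono (allFin n) pointwise ⟩
  # q                                              ∎
  where
  open ≤-Reasoning
  self : Fin n → Bool
  self x = does (x Finₚ.≟ x₀)
  pointwise : ∀ x → 𝟙 (self x) + 𝟙 (p x) ≤ 𝟙 (q x)
  pointwise x with x Finₚ.≟ x₀
  ... | yes refl rewrite px₀ | qx₀ = ≤-refl
  ... | no _ = 𝟙-mono (imp x)

inject-elems : (p : Fin n → Bool) (t : ℕ) → t ≤ # p →
  Σ (Fin t → Fin n) λ f → (∀ i j → f i ≡ f j → i ≡ j) × (∀ i → p (f i) ≡ true)
inject-elems p t le = (λ i → lookup (elems p) (inject≤ i le′))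
  , (λ i j eq → Finₚ.inject≤-injective le′ le′ i j (unique-lookup-injective (elems-unique p) _ _ eq))
  , (λ i → ∈-elems⁻ p (∈-lookup (inject≤ i le′)))
  where
  le′ : t ≤ length (elems p)
  le′ = subst (t ≤_) (sym (length-elems p)) le

infix 4 _∈?_
_∈?_ : (x : Fin n) (L : List (Fin n)) → Dec (x ∈ L)
x ∈? L = Any.any? (x Finₚ.≟_) L

escape : (p : Fin n → Bool) (L : List (Fin n)) → length L < # p → Σ (Fin n) λ x → p x ≡ true × x ∉ L
escape p L lt with Finₚ.any? (λ x → helper x)
  where
  helper : ∀ x → Dec (p x ≡ true × x ∉ L)
  helper x = (p x Boolₚ.≟ true) ×-dec ¬? (x ∈? L)
... | yes r = r
... | no none = contradiction (#-list L p sub) (<⇒≱ lt)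
  where
  sub : ∀ x → p x ≡ true → x ∈ L
  sub x px with x ∈? L
  ... | yes x∈ = x∈
  ... | no x∉ = contradiction (x , px , x∉) none

-- Serves for the positions of the vertices of a tournament, with an injective key, and for the
-- levels of the vertices of `H`, where keys may tie. Tied vertices share a rank and the following
-- ranks are skipped, so some levels can be empty.
module Rank {n : ℕ} (key : Fin n → ℕ) where

  rank : Fin n → ℕ
  rank v = # (λ u → does (key u <? key v))

  rank-mono-≤ : ∀ {u v} → key u ≤ key v → rank u ≤ rank v
  rank-mono-≤ {u} {v} le = #-mono
    (λ x p → dec-true (key x <? key v) (<-≤-trans (does-true (key x <? key u) p) le))

  rank-mono-< : ∀ {u v} → key u < key v → rank u < rank v
  rank-mono-< {u} {v} lt = #-mono-< u
    (λ x p → dec-true (key x <? key v) (<-trans (does-true (key x <? key u) p) lt))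
    (dec-false (key u <? key u) (<-irrefl refl)) (dec-true (key u <? key v) lt)

  rank-cancel-< : ∀ {u v} → rank u < rank v → key u < key v
  rank-cancel-< {u} {v} lt with key u <? key v
  ... | yes p = p
  ... | no ¬p = contradiction (rank-mono-≤ (≮⇒≥ ¬p)) (<⇒≱ lt)

  rank-cancel-≡ : ∀ {u v} → rank u ≡ rank v → key u ≡ key v
  rank-cancel-≡ eq = ≤-antisym
    (≮⇒≥ (λ lt → <-irrefl (sym eq) (rank-mono-< lt)))
    (≮⇒≥ (λ lt → <-irrefl eq (rank-mono-< lt)))

  rank<n : ∀ v → rank v < n
  rank<n v = subst (rank v <_) #-all
    (#-mono-< v (λ _ _ → refl) (dec-false (key v <? key v) (<-irrefl refl)) refl)

-- Degrees in tournaments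

infixl 25 _ᵒᵖ
_ᵒᵖ : Digraph n → Digraph n
(G ᵒᵖ) x y = G y x

op-tournament : {T : Digraph n} → Tournament T → Tournament (T ᵒᵖ)
op-tournament (simple , total) = simple , λ x y x≢y → total y x (x≢y ∘ sym)

outdeg indeg : Digraph n → Fin n → ℕ
outdeg G x = # (G x)
indeg  G x = # (λ y → G y x)

module _ {T : Digraph n} (tour : Tournament T) where

  arc-asym : ∀ {x y} → Arc T x y → T y x ≡ false
  arc-asym {x} {y} a with T y x in eq
  ... | false = refl
  ... | true with x Finₚ.≟ y
  ...   | yes refl = contradiction a (proj₁ tour x)
  ...   | no x≢y = contradiction (a , eq) (proj₂ (proj₂ tour x y x≢y))

  arc-total : ∀ {x y} → x ≢ y → ¬ Arc T x y → Arc T y x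
  arc-total {x} {y} x≢y ¬a with proj₁ (proj₂ tour x y x≢y)
  ... | inj₁ a = contradiction a ¬a
  ... | inj₂ a = a

  trichotomy : ∀ x y → 𝟙 (T x y) + 𝟙 (T y x) + 𝟙 (does (y Finₚ.≟ x)) ≡ 1
  trichotomy x y with y Finₚ.≟ x
  ... | yes refl rewrite Boolₚ.¬-not (proj₁ tour x) = refl
  ... | no y≢x with T x y in eq
  ...   | true rewrite arc-asym eq = refl
  ...   | false rewrite arc-total (y≢x ∘ sym) (λ a → contradiction (trans (sym eq) a) λ ()) = refl

  degree-sum : ∀ x → outdeg T x + indeg T x + 1 ≡ n
  degree-sum x = begin
    outdeg T x + indeg T x + 1
      ≡⟨ cong₂ _+_ (sym (∑-+ (allFin n) _ _)) (sym (#-self x)) ⟩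
    ∑ (allFin n) (λ y → 𝟙 (T x y) + 𝟙 (T y x)) + # (λ y → does (y Finₚ.≟ x))
      ≡⟨ ∑-+ (allFin n) _ _ ⟨
    ∑ (allFin n) (λ y → 𝟙 (T x y) + 𝟙 (T y x) + 𝟙 (does (y Finₚ.≟ x)))
      ≡⟨ ≤-antisym (∑-mono (allFin n) (λ y → ≤-reflexive (trichotomy x y))) (∑-mono (allFin n) (λ y → ≤-reflexive (sym (trichotomy x y)))) ⟩
    ∑ (allFin n) (λ _ → 1)
      ≡⟨ ∑-allFin-one ⟩
    n ∎
    where open ≡-Reasoning

  -- Double counting of Z × Z: each pair is an arc in one of the directions or a loop.
  small-indegrees : (Z : Fin n → Bool) (E : ℕ) →
    (∀ x → Z x ≡ true → # (λ y → Z y ∧ T y x) ≤ E) → # Z ≤ E + E + 1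
  small-indegrees Z E bound = cancel (# Z) total
    where
    open ≤-Reasoning
    V = allFin n
    into : Fin n → Fin n → ℕ
    into x y = 𝟙 (Z x) * 𝟙 (Z y ∧ T y x)
    cancel : ∀ z → z * z ≤ (E + E + 1) * z → z ≤ E + E + 1
    cancel zero    _  = z≤n
    cancel (suc z) le = *-cancelʳ-≤ (suc z) (E + E + 1) (suc z) le
    pointwise : ∀ x y → 𝟙 (Z x) * 𝟙 (Z y) ≤ into x y + into y x + 𝟙 (Z x) * 𝟙 (does (y Finₚ.≟ x))
    pointwise x y with Z x | Z y | trichotomy x y
    ... | false | _     | _ = z≤n
    ... | true  | false | _ = z≤n
    ... | true  | true  | tri = ≤-reflexive (trans (sym tri) (rearrange (𝟙 (T x y)) (𝟙 (T y x)) _))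
      where
      rearrange : ∀ a b c → a + b + c ≡ 1 * b + 1 * a + 1 * c
      rearrange = solve-∀
    inner : ∀ x → ∑ V (into x) ≤ E * 𝟙 (Z x)
    inner x = begin
      ∑ V (into x)                        ≡⟨ ∑-*ˡ V (𝟙 (Z x)) _ ⟩
      𝟙 (Z x) * # (λ y → Z y ∧ T y x)     ≤⟨ scaled ⟩
      E * 𝟙 (Z x)                         ∎
      where
      scaled : 𝟙 (Z x) * # (λ y → Z y ∧ T y x) ≤ E * 𝟙 (Z x)
      scaled with Z x in eq
      ... | false = z≤n
      ... | true  = ≤-trans (≤-reflexive (*-identityˡ _)) (≤-trans (bound x eq) (≤-reflexive (sym (*-identityʳ E))))
    outer : ∑ V (λ x → ∑ V (into x)) ≤ E * # Z
    outer = ≤-trans (∑-mono V inner) (≤-reflexive (∑-*ˡ V E _))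
    diagonal : ∑ V (λ x → ∑ V (λ y → 𝟙 (Z x) * 𝟙 (does (y Finₚ.≟ x)))) ≤ # Z
    diagonal = ∑-mono V (λ x → ≤-reflexive (trans (∑-*ˡ V (𝟙 (Z x)) _) (trans (cong (𝟙 (Z x) *_) (#-self x)) (*-identityʳ _))))
    square : # Z * # Z ≡ ∑ V (λ x → ∑ V (λ y → 𝟙 (Z x) * 𝟙 (Z y)))
    square = trans (sym (∑-*ˡ V (# Z) (𝟙 ∘ Z)))
      (≤-antisym (∑-mono V (λ x → ≤-reflexive (row x))) (∑-mono V (λ x → ≤-reflexive (sym (row x)))))
      where
      row : ∀ x → # Z * 𝟙 (Z x) ≡ ∑ V (λ y → 𝟙 (Z x) * 𝟙 (Z y))
      row x = trans (*-comm (# Z) _) (sym (∑-*ˡ V (𝟙 (Z x)) _))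
    total : # Z * # Z ≤ (E + E + 1) * # Z
    total = begin
      # Z * # Z
        ≡⟨ square ⟩
      ∑ V (λ x → ∑ V (λ y → 𝟙 (Z x) * 𝟙 (Z y)))
        ≤⟨ ∑-mono V (λ x → ≤-trans (∑-mono V (pointwise x)) (≤-reflexive (∑-+₃ V _ _ _))) ⟩
      ∑ V (λ x → ∑ V (into x) + ∑ V (λ y → into y x) + ∑ V (λ y → 𝟙 (Z x) * 𝟙 (does (y Finₚ.≟ x))))
        ≡⟨ ∑-+₃ V _ _ _ ⟩
      ∑ V (λ x → ∑ V (into x)) + ∑ V (λ x → ∑ V (λ y → into y x)) + ∑ V (λ x → ∑ V (λ y → 𝟙 (Z x) * 𝟙 (does (y Finₚ.≟ x))))
        ≤⟨ +-mono-≤ (+-mono-≤ outer (≤-trans (≤-reflexive (∑-swap V V (λ x y → into y x))) outer)) diagonal ⟩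
      E * # Z + E * # Z + # Z
        ≡⟨ collect E (# Z) ⟩
      (E + E + 1) * # Z ∎
      where
      collect : ∀ a z → a * z + a * z + z ≡ (a + a + 1) * z
      collect = solve-∀

-- Robust links

Avoids : List (Fin n) → Fin n × Fin n → Set
Avoids L e = proj₁ e ∉ L ⊎ proj₂ e ∉ L

-- The bound 4 is the length of the longest route constructed, the one in `heads⇒robust`.
Link : Digraph n → List (Fin n) → Fin n → Fin n → Set
Link G L x y = Σ (Walk G x y) λ w → length (arcs w) ≤ 4 × All (Avoids L) (arcs w)

Robust : Digraph n → ℕ → Fin n → Fin n → Set
Robust G m x y = ∀ L → length L ≤ m → Link G L x y

snoc : {G : Digraph n} {x y z : Fin n} → Walk G x y → Arc G y z → Walk G x z
snoc stop       a = step a stop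
snoc (step b w) a = step b (snoc w a)

arcs-snoc : {G : Digraph n} {x y z : Fin n} (w : Walk G x y) (a : Arc G y z) →
  arcs (snoc w a) ≡ arcs w ++ (y , z) ∷ []
arcs-snoc stop       a = refl
arcs-snoc (step b w) a = cong (_ ∷_) (arcs-snoc w a)

reverseWalk : {G : Digraph n} {x y : Fin n} → Walk (G ᵒᵖ) x y → Walk G y x
reverseWalk stop       = stop
reverseWalk (step a w) = snoc (reverseWalk w) a

length-reverseWalk : {G : Digraph n} {x y : Fin n} (w : Walk (G ᵒᵖ) x y) →
  length (arcs (reverseWalk {G = G} w)) ≡ length (arcs w)
length-reverseWalk stop = refl
length-reverseWalk {G = G} (step {x} {y} a w) = begin
  length (arcs (snoc w′ a))          ≡⟨ cong length (arcs-snoc w′ a) ⟩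
  length (arcs w′ ++ (y , x) ∷ [])   ≡⟨ length-++ (arcs w′) ⟩
  length (arcs w′) + 1               ≡⟨ +-comm (length (arcs w′)) 1 ⟩
  suc (length (arcs w′))             ≡⟨ cong suc (length-reverseWalk {G = G} w) ⟩
  suc (length (arcs w))              ∎
  where
  open ≡-Reasoning
  w′ = reverseWalk {G = G} w

avoids-reverseWalk : {G : Digraph n} {L : List (Fin n)} {x y : Fin n} (w : Walk (G ᵒᵖ) x y) →
  All (Avoids L) (arcs w) → All (Avoids L) (arcs (reverseWalk {G = G} w))
avoids-reverseWalk stop       []       = []
avoids-reverseWalk {G = G} (step a w) (p ∷ ps)
  rewrite arcs-snoc (reverseWalk {G = G} w) a =
  Allₚ.++⁺ (avoids-reverseWalk w ps) (Sum.swap p ∷ [])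

robust-op : {G : Digraph n} {m : ℕ} {x y : Fin n} → Robust (G ᵒᵖ) m x y → Robust G m y x
robust-op {G = G} r L le with r L le
... | w , len , av = reverseWalk w , subst (_≤ 4) (sym (length-reverseWalk {G = G} w)) len , avoids-reverseWalk w av

-- Vertices of nearly equal outdegree

private
  -- For `z` in `Z ∩ A`, the out-neighbours of `z` and its in-neighbours in `Z ∩ A` are disjoint and
  -- lie in `A ∪ R`, which has at most `outdeg T u + ρ` elements. As `outdeg T z` falls short of
  -- `outdeg T u` by at most `δ`, only `δ + ρ` such in-neighbours remain, and double counting
  -- applies.
  in-small : {T : Digraph n} → Tournament T → (Z A R : Fin n → Bool) (u : Fin n) (δ ρ : ℕ) →
    (∀ x → A x ≡ true → Arc T u x) →
    (∀ z y → A z ≡ true → Arc T z y → 1 ≤ 𝟙 (A y) + 𝟙 (R y)) →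
    (∀ z → Z z ≡ true → outdeg T u ≤ outdeg T z + δ) →
    # R ≤ ρ → # (λ x → Z x ∧ A x) ≤ (δ + ρ) + (δ + ρ) + 1
  in-small {n} {T} tour Z A R u δ ρ A⊆ closed close R≤ =
    small-indegrees tour (λ x → Z x ∧ A x) (δ + ρ) bound
    where
    open ≤-Reasoning
    pointwise : ∀ z → A z ≡ true → ∀ y → 𝟙 ((Z y ∧ A y) ∧ T y z) + 𝟙 (T z y) ≤ 𝟙 (A y) + 𝟙 (R y)
    pointwise z Az y with T z y in eq
    ... | true rewrite arc-asym tour eq | Boolₚ.∧-zeroʳ (Z y ∧ A y) = closed z y Az eq
    ... | false rewrite +-identityʳ (𝟙 ((Z y ∧ A y) ∧ T y z)) =
      ≤-trans (𝟙-mono (λ p → ∧-snd {Z y} (∧-fst {Z y ∧ A y} p))) (m≤m+n (𝟙 (A y)) _)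
    bound : ∀ z → Z z ∧ A z ≡ true → # (λ y → (Z y ∧ A y) ∧ T y z) ≤ δ + ρ
    bound z p = +-cancelʳ-≤ (outdeg T z) _ _ (begin
      # (λ y → (Z y ∧ A y) ∧ T y z) + outdeg T z
        ≡⟨ ∑-+ (allFin n) _ _ ⟨
      ∑ (allFin n) (λ y → 𝟙 ((Z y ∧ A y) ∧ T y z) + 𝟙 (T z y))
        ≤⟨ ∑-mono (allFin n) (pointwise z (∧-snd {Z z} p)) ⟩
      ∑ (allFin n) (λ y → 𝟙 (A y) + 𝟙 (R y))
        ≡⟨ ∑-+ (allFin n) _ _ ⟩
      # A + # R
        ≤⟨ +-mono-≤ (≤-trans (#-mono A⊆) (close z (∧-fst {Z z} p))) R≤ ⟩
      outdeg T z + δ + ρ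
        ≡⟨ rearrange (outdeg T z) δ ρ ⟩
      δ + ρ + outdeg T z ∎)
      where
      rearrange : ∀ a b c → a + b + c ≡ b + c + a
      rearrange = solve-∀

∉-true : ∀ {x : Fin n} {L} → not (does (x ∈? L)) ≡ true → x ∉ L
∉-true {x = x} {L} = does-not (x ∈? L)

#-remove : (p : Fin n → Bool) (L : List (Fin n)) → # p ≤ # (λ x → p x ∧ not (does (x ∈? L))) + length L
#-remove {n} p L = begin
  # p                                                                             ≤⟨ ∑-mono (allFin n) pointwise ⟩
  ∑ (allFin n) (λ x → 𝟙 (p x ∧ not (does (x ∈? L))) + 𝟙 (does (x ∈? L)))          ≡⟨ ∑-+ (allFin n) _ _ ⟩
  # (λ x → p x ∧ not (does (x ∈? L))) + # (λ x → does (x ∈? L))                   ≤⟨ +-monoʳ-≤ (# (λ x → p x ∧ not (does (x ∈? L)))) (#-list L _ (λ x → does-true (x ∈? L))) ⟩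
  # (λ x → p x ∧ not (does (x ∈? L))) + length L                                  ∎
  where
  open ≤-Reasoning
  pointwise : ∀ x → 𝟙 (p x) ≤ 𝟙 (p x ∧ not (does (x ∈? L))) + 𝟙 (does (x ∈? L))
  pointwise x with p x | does (x ∈? L)
  ... | false | _     = z≤n
  ... | true  | true  = ≤-refl
  ... | true  | false = ≤-refl

module _ {T : Digraph n} (tour : Tournament T) where

  indeg-close : ∀ {x y δ} → outdeg T x ≤ outdeg T y + δ → indeg T y ≤ indeg T x + δ
  indeg-close {x} {y} {δ} le = +-cancelˡ-≤ (outdeg T y + 1) _ _ (begin
    outdeg T y + 1 + indeg T y    ≡⟨ shift (outdeg T y) (indeg T y) ⟩
    outdeg T y + indeg T y + 1    ≡⟨ trans (degree-sum tour y) (sym (degree-sum tour x)) ⟩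
    outdeg T x + indeg T x + 1    ≤⟨ +-monoˡ-≤ 1 (+-monoˡ-≤ (indeg T x) le) ⟩
    outdeg T y + δ + indeg T x + 1 ≡⟨ shift₂ (outdeg T y) δ (indeg T x) ⟩
    outdeg T y + 1 + (indeg T x + δ) ∎)
    where
    open ≤-Reasoning
    shift : ∀ a b → a + 1 + b ≡ a + b + 1
    shift = solve-∀
    shift₂ : ∀ a b c → a + b + c + 1 ≡ a + 1 + (c + b)
    shift₂ = solve-∀

  -- If u cannot reach v then N⁺(u) and N⁻(v) almost partition the vertices and no arc goes
  -- from the former to the latter, so neither contains many vertices of about average outdegree.
  close-degrees⇒robust : (Z : Fin n → Bool) (δ m : ℕ) →
    (∀ x y → Z x ≡ true → Z y ≡ true → outdeg T x ≤ outdeg T y + δ) →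
    9 * δ + 10 * m + 7 < # Z →
    ∀ u v → Z u ≡ true → Z v ≡ true → Robust T m u v
  close-degrees⇒robust Z δ m close large u v Zu Zv L L≤ with
      Finₚ.any? (λ x → (A x Boolₚ.≟ true) ×-dec (B x Boolₚ.≟ true))
    | Finₚ.any? (λ x → Finₚ.any? (λ y → (A x Boolₚ.≟ true) ×-dec (B y Boolₚ.≟ true) ×-dec (T x y Boolₚ.≟ true)))
    where
    A B : Fin n → Bool
    A x = T u x ∧ not (does (x ∈? L))
    B x = T x v ∧ not (does (x ∈? L))
  ... | yes (x , Ax , Bx) | _ =
    step (∧-fst {T u x} Ax) (step (∧-fst {T x v} Bx) stop) , s≤s (s≤s z≤n) , inj₂ x∉ ∷ inj₁ x∉ ∷ []
    where x∉ = ∉-true (∧-snd {T u x} Ax)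
  ... | no _ | yes (x , y , Ax , By , xy) =
    step (∧-fst {T u x} Ax) (step xy (step (∧-fst {T y v} By) stop)) , s≤s (s≤s (s≤s z≤n)) ,
    inj₂ x∉ ∷ inj₁ x∉ ∷ inj₁ (∉-true (∧-snd {T y v} By)) ∷ []
    where x∉ = ∉-true (∧-snd {T u x} Ax)
  ... | no no₂ | no no₃ = contradiction small (<⇒≱ large)
    where
    open ≤-Reasoning
    V = allFin n
    A B R : Fin n → Bool
    A x = T u x ∧ not (does (x ∈? L))
    B x = T x v ∧ not (does (x ∈? L))
    R x = not (A x) ∧ not (B x)
    -- Vertices outside `A` and `B`: the term 1 comes from the degree sum at `v`, `m` from removing
    -- `L` in each of the two neighbourhoods, and `δ` from replacing `outdeg T v` by `outdeg T u`.
    ρ = δ + 1 + (m + m)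
    partition : ∀ x → 𝟙 (A x) + 𝟙 (B x) + 𝟙 (R x) ≡ 1
    partition x with A x in a | B x in b
    ... | true  | true  = contradiction (x , a , b) no₂
    ... | true  | false = refl
    ... | false | true  = refl
    ... | false | false = refl
    R≤ : # R ≤ ρ
    R≤ = +-cancelʳ-≤ (outdeg T u + indeg T v) _ _ (begin
      # R + (outdeg T u + indeg T v)
        ≤⟨ +-monoʳ-≤ (# R) (+-mono-≤ (≤-trans (#-remove (T u) L) (+-monoʳ-≤ (# A) L≤)) (≤-trans (#-remove (λ x → T x v) L) (+-monoʳ-≤ (# B) L≤))) ⟩
      # R + (# A + m + (# B + m))
        ≡⟨ shift (# R) (# A) (# B) m ⟩
      # A + # B + # R + (m + m)
        ≡⟨ cong (_+ (m + m)) (∑-+₃ V (𝟙 ∘ A) (𝟙 ∘ B) (𝟙 ∘ R)) ⟨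
      ∑ V (λ x → 𝟙 (A x) + 𝟙 (B x) + 𝟙 (R x)) + (m + m)
        ≤⟨ +-monoˡ-≤ (m + m) (∑-mono V (λ x → ≤-reflexive (partition x))) ⟩
      ∑ V (λ _ → 1) + (m + m)
        ≡⟨ cong (_+ (m + m)) (trans (∑-allFin-one {n}) (sym (degree-sum tour v))) ⟩
      outdeg T v + indeg T v + 1 + (m + m)
        ≤⟨ +-monoˡ-≤ (m + m) (+-monoˡ-≤ 1 (+-monoˡ-≤ (indeg T v) (close v u Zv Zu))) ⟩
      outdeg T u + δ + indeg T v + 1 + (m + m)
        ≡⟨ shift₂ (outdeg T u) δ (indeg T v) (m + m) ⟩
      ρ + (outdeg T u + indeg T v) ∎)
      where
      shift : ∀ r a b m → r + (a + m + (b + m)) ≡ a + b + r + (m + m)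
      shift = solve-∀
      shift₂ : ∀ a d i m → a + d + i + 1 + m ≡ d + 1 + m + (a + i)
      shift₂ = solve-∀
    A-closed : ∀ z y → A z ≡ true → Arc T z y → 1 ≤ 𝟙 (A y) + 𝟙 (R y)
    A-closed z y Az zy with A y | B y in b
    ... | true  | _     = s≤s z≤n
    ... | false | true  = contradiction (z , y , Az , b , zy) no₃
    ... | false | false = s≤s z≤n
    B-closed : ∀ z y → B z ≡ true → Arc T y z → 1 ≤ 𝟙 (B y) + 𝟙 (R y)
    B-closed z y Bz yz with A y in a | B y
    ... | _     | true  = s≤s z≤n
    ... | true  | false = contradiction (y , z , a , Bz , yz) no₃
    ... | false | false = s≤s z≤n
    cover : ∀ x → 𝟙 (Z x) ≤ 𝟙 (Z x ∧ A x) + 𝟙 (Z x ∧ B x) + 𝟙 (R x)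
    cover x with Z x
    ... | false = z≤n
    ... | true  = ≤-reflexive (sym (partition x))
    small : # Z ≤ 9 * δ + 10 * m + 7
    small = begin
      # Z
        ≤⟨ ∑-mono V cover ⟩
      ∑ V (λ x → 𝟙 (Z x ∧ A x) + 𝟙 (Z x ∧ B x) + 𝟙 (R x))
        ≡⟨ ∑-+₃ V _ _ _ ⟩
      # (λ x → Z x ∧ A x) + # (λ x → Z x ∧ B x) + # R
        ≤⟨ +-mono-≤ (+-mono-≤
             (in-small tour Z A R u δ ρ (λ x → ∧-fst {T u x}) A-closed (λ z Zz → close u z Zu Zz) R≤)
             (in-small (op-tournament tour) Z B R v δ ρ (λ x → ∧-fst {T x v}) B-closed
               (λ z Zz → indeg-close (close z v Zz Zv)) R≤)) R≤ ⟩
      ((δ + ρ) + (δ + ρ) + 1) + ((δ + ρ) + (δ + ρ) + 1) + ρ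
        ≡⟨ total δ m ⟩
      9 * δ + 10 * m + 7 ∎
      where
      total : ∀ δ m → let ρ = δ + 1 + (m + m) in
        ((δ + ρ) + (δ + ρ) + 1) + ((δ + ρ) + (δ + ρ) + 1) + ρ ≡ 9 * δ + 10 * m + 7
      total = solve-∀

#-split : (p q : Fin n → Bool) → # p ≤ # (λ x → p x ∧ q x) + # (λ x → p x ∧ not (q x))
#-split {n} p q = ≤-trans (∑-mono (allFin n) pointwise) (≤-reflexive (∑-+ (allFin n) _ _))
  where
  pointwise : ∀ x → 𝟙 (p x) ≤ 𝟙 (p x ∧ q x) + 𝟙 (p x ∧ not (q x))
  pointwise x with p x | q x
  ... | false | _     = z≤n
  ... | true  | true  = ≤-refl
  ... | true  | false = ≤-refl

RobustFamily : Digraph n → ℕ → ℕ → Set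
RobustFamily {n} G m h = Σ (Fin h → Fin n) λ φ →
  (∀ u v → φ u ≡ φ v → u ≡ v) × (∀ u v → Robust G m (φ u) (φ v))

robustFamily-op : {G : Digraph n} {m h : ℕ} → RobustFamily (G ᵒᵖ) m h → RobustFamily G m h
robustFamily-op {G = G} (φ , inj , r) = φ , inj , λ u v → robust-op {G = G} (r v u)

robustSet : {G : Digraph n} {m h : ℕ} (Z : Fin n → Bool) → h ≤ # Z →
  (∀ u v → Z u ≡ true → Z v ≡ true → Robust G m u v) → RobustFamily G m h
robustSet {h = h} Z h≤ r with inject-elems Z h h≤
... | φ , inj , φ∈ = φ , inj , λ u v → r (φ u) (φ v) (φ∈ u) (φ∈ v)

module _ {T : Digraph n} (tour : Tournament T) where

  -- Two vertices x, x′ of large outdegree are linked by x → z → y → l → x′, where y → l is one of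
  -- the given arcs and l is an in-neighbour of x′ of large outdegree.
  heads⇒robust : (P : Fin n → Bool) (α m h : ℕ) →
    (∀ x → P x ≡ true → α ≤ outdeg T x × Σ (Fin n) λ y → Arc T y x × outdeg T y ≤ α) →
    21 * m + 18 + 2 * h ≤ # P → RobustFamily T m h
  heads⇒robust P α m h partner large with 19 * m + 17 + h ≤? # low
    where
    low : Fin n → Bool
    low x = P x ∧ does (outdeg T x ≤? α + suc m)
  -- All outdegrees in `low` lie between `α` and `α + suc m`, so they are nearly equal with
  -- `δ = suc m`.
  ... | yes low≥ = robustSet low (≤-trans (m≤n+m h (19 * m + 17)) low≥)
      (close-degrees⇒robust tour low (suc m) m close
        (≤-trans (≤-trans (≤-reflexive (bound m)) (m≤m+n _ h)) low≥))
    where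
    low : Fin n → Bool
    low x = P x ∧ does (outdeg T x ≤? α + suc m)
    bound : ∀ m → suc (9 * suc m + 10 * m + 7) ≡ 19 * m + 17
    bound = solve-∀
    close : ∀ x y → low x ≡ true → low y ≡ true → outdeg T x ≤ outdeg T y + suc m
    close x y lx ly = ≤-trans (does-true (outdeg T x ≤? α + suc m) (∧-snd {P x} lx))
      (+-monoˡ-≤ (suc m) (proj₁ (partner y (∧-fst {P y} ly))))
  ... | no low≱ = robustSet good good≥ linked
    where
    open ≤-Reasoning hiding (stop)
    low high bad good : Fin n → Bool
    low x = P x ∧ does (outdeg T x ≤? α + suc m)
    high x = P x ∧ not (does (outdeg T x ≤? α + suc m))
    manyIn : Fin n → Bool
    manyIn x = does (m <? # (λ y → high y ∧ T y x))
    good x = high x ∧ manyIn x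
    bad x = high x ∧ not (manyIn x)
    high≥ : 2 * m + 1 + h ≤ # high
    high≥ = +-cancelˡ-≤ (19 * m + 17 + h) _ _ (begin
      19 * m + 17 + h + (2 * m + 1 + h) ≡⟨ rearrange m h ⟩
      21 * m + 18 + 2 * h               ≤⟨ large ⟩
      # P                               ≤⟨ #-split P (λ x → does (outdeg T x ≤? α + suc m)) ⟩
      # low + # high                    ≤⟨ +-monoˡ-≤ (# high) (<⇒≤ (≰⇒> low≱)) ⟩
      19 * m + 17 + h + # high          ∎)
      where
      rearrange : ∀ m h → 19 * m + 17 + h + (2 * m + 1 + h) ≡ 21 * m + 18 + 2 * h
      rearrange = solve-∀
    -- A bad vertex has at most `m` in-neighbours in `high`, hence in `bad`, so double counting
    -- limits `bad`. A good vertex keeps an in-neighbour in `high` off every `L`.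
    bad≤ : # bad ≤ m + m + 1
    bad≤ = small-indegrees tour bad m (λ x bx → ≤-trans
      (#-mono (λ y p → ∧-intro (∧-fst {high y} (∧-fst {bad y} p)) (∧-snd {bad y} p)))
      (≮⇒≥ (does-not (m <? # (λ y → high y ∧ T y x)) (∧-snd {high x} bx))))
    good≥ : h ≤ # good
    good≥ = +-cancelˡ-≤ (2 * m + 1) _ _ (begin
      2 * m + 1 + h       ≤⟨ high≥ ⟩
      # high              ≤⟨ #-split high manyIn ⟩
      # good + # bad      ≤⟨ +-monoʳ-≤ (# good) bad≤ ⟩
      # good + (m + m + 1) ≡⟨ rearrange (# good) m ⟩
      2 * m + 1 + # good  ∎)
      where
      rearrange : ∀ g m → g + (m + m + 1) ≡ 2 * m + 1 + g
      rearrange = solve-∀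
    linked : ∀ x x′ → good x ≡ true → good x′ ≡ true → Robust T m x x′
    linked x x′ gx gx′ L L≤
      with escape (λ y → high y ∧ T y x′) L
             (≤-<-trans L≤ (does-true (m <? # (λ y → high y ∧ T y x′)) (∧-snd {high x′} gx′)))
    ... | l , hl , l∉ with partner l (∧-fst {P l} (∧-fst {high l} hl))
    ...   | _ , y , yl , y≤ with escape (λ z → T x z ∧ not (T y z)) (y ∷ L) many
      where
      -- As `outdeg T y` is at most `α` and `outdeg T x` exceeds `α + suc m`, more than `suc m`
      -- out-neighbours of `x` are not out-neighbours of `y`. One of them is off `L` and distinct
      -- from `y`, so it has an arc to `y`.
      many : suc (length L) < # (λ z → T x z ∧ not (T y z))
      many = +-cancelˡ-< (outdeg T y) _ _ (begin-strict
        outdeg T y + suc (length L)  ≤⟨ +-mono-≤ y≤ (s≤s L≤) ⟩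
        α + suc m                    <⟨ ≰⇒> (does-not (outdeg T x ≤? α + suc m) (∧-snd {P x} (∧-fst {high x} gx))) ⟩
        outdeg T x                   ≤⟨ #-split (T x) (T y) ⟩
        # (λ z → T x z ∧ T y z) + # (λ z → T x z ∧ not (T y z))
          ≤⟨ +-monoˡ-≤ _ (#-mono (λ z → ∧-snd {T x z})) ⟩
        outdeg T y + # (λ z → T x z ∧ not (T y z)) ∎)
    ...     | z , pz , z∉ =
      step (∧-fst {T x z} pz) (step zy (step yl (step (∧-snd {high l} hl) stop))) , ≤-refl ,
      inj₂ (z∉ ∘ there) ∷ inj₁ (z∉ ∘ there) ∷ inj₂ l∉ ∷ inj₁ l∉ ∷ []
      where
      zy : Arc T z y
      zy = arc-total tour (λ y≡z → z∉ (here (sym y≡z)))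
        (λ yz → contradiction (trans (sym (cong not yz)) (∧-snd {T x z} pz)) λ ())

-- Ordering by outdegree

injective⇒surjective : (f : Fin n → Fin n) → (∀ x y → f x ≡ f y → x ≡ y) → ∀ y → Σ (Fin n) λ x → f x ≡ y
injective⇒surjective {suc n} f inj y with Finₚ.any? (λ x → f x Finₚ.≟ y)
... | yes r = r
... | no ¬r = contradiction (Finₚ.injective⇒≤ {f = λ x → punchOut (avoid x)}
    (λ {x} {x′} eq → inj x x′ (Finₚ.punchOut-injective (avoid x) (avoid x′) eq))) 1+n≰n
  where
  avoid : ∀ x → y ≢ f x
  avoid x eq = ¬r (x , sym eq)

record Ordering {n : ℕ} (G : Digraph n) : Set where
  field
    pos       : Fin n → ℕ
    pos-inj   : ∀ {x y} → pos x ≡ pos y → x ≡ y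
    pos<n     : ∀ x → pos x < n
    pos-deg   : ∀ {x y} → pos x < pos y → outdeg G y ≤ outdeg G x

  pos-surj : ∀ {p} → p < n → Σ (Fin n) λ x → pos x ≡ p
  pos-surj p<n with injective⇒surjective (λ x → fromℕ< (pos<n x)) (λ x y eq → pos-inj (Finₚ.fromℕ<-injective _ _ _ _ eq)) (fromℕ< p<n)
  ... | x , eq = x , Finₚ.fromℕ<-injective _ _ (pos<n x) p<n eq

-- The key encodes the pair (`n ∸ outdeg G x`, `x`) lexicographically as one number. The second
-- component breaks ties, so the ranks are distinct positions.
outdegreeOrdering : (G : Digraph n) → Ordering G
outdegreeOrdering {n} G = record
  { pos     = rank
  ; pos-inj = λ eq → proj₂ (Finₚ.combine-injective (band _) _ (band _) _ (Finₚ.toℕ-injective (rank-cancel-≡ eq)))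
  ; pos<n   = rank<n
  ; pos-deg = λ {x} {y} lt → ≮⇒≥ (λ dx<dy → <-asym (rank-cancel-< lt)
      (Finₚ.combine-monoˡ-< y x (subst₂ _<_ (sym (toℕ-band y)) (sym (toℕ-band x))
        (∸-monoʳ-< dx<dy (outdeg≤n y)))))
  }
  where
  outdeg≤n : ∀ x → outdeg G x ≤ n
  outdeg≤n x = ≤-trans (#-mono {p = G x} (λ _ _ → refl)) (≤-reflexive (#-all {n}))
  band : Fin n → Fin (suc n)
  band x = fromℕ< {n ∸ outdeg G x} (s≤s (m∸n≤m n (outdeg G x)))
  toℕ-band : ∀ x → toℕ (band x) ≡ n ∸ outdeg G x
  toℕ-band x = Finₚ.toℕ-fromℕ< (s≤s (m∸n≤m n (outdeg G x)))
  key : Fin n → ℕ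
  key x = toℕ (combine (band x) x)
  open Rank key

-- Backward arcs across a cut

length-cartesianProduct : {A B : Set} (xs : List A) (ys : List B) →
  length (cartesianProduct xs ys) ≡ length xs * length ys
length-cartesianProduct []       ys = refl
length-cartesianProduct (x ∷ xs) ys = trans (length-++ (map (x ,_) ys))
  (cong₂ _+_ (length-map (x ,_) ys) (length-cartesianProduct xs ys))

pairs : ∀ n → List (Fin n × Fin n)
pairs n = cartesianProduct (allFin n) (allFin n)

∈-pairs : (e : Fin n × Fin n) → e ∈ pairs n
∈-pairs (x , y) = ∈-cartesianProduct⁺ (∈-allFin x) (∈-allFin y)

pairs-unique : ∀ n → Unique (pairs n)
pairs-unique n = Uniqueₚ.cartesianProduct⁺ (Uniqueₚ.allFin⁺ n) (Uniqueₚ.allFin⁺ n)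

arcsWhere : (Fin n → Fin n → Bool) → List (Fin n × Fin n)
arcsWhere G = filter (λ e → G (proj₁ e) (proj₂ e) Boolₚ.≟ true) (pairs _)

∈-arcsWhere⁺ : (G : Fin n → Fin n → Bool) {e : Fin n × Fin n} → G (proj₁ e) (proj₂ e) ≡ true → e ∈ arcsWhere G
∈-arcsWhere⁺ G p = ∈-filter⁺ (λ e → G (proj₁ e) (proj₂ e) Boolₚ.≟ true) (∈-pairs _) p

∈-arcsWhere⁻ : (G : Fin n → Fin n → Bool) {e : Fin n × Fin n} → e ∈ arcsWhere G → G (proj₁ e) (proj₂ e) ≡ true
∈-arcsWhere⁻ {n} G e∈ = proj₂ (∈-filter⁻ (λ e → G (proj₁ e) (proj₂ e) Boolₚ.≟ true) {xs = pairs n} e∈)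

arcsWhere-unique : (G : Fin n → Fin n → Bool) → Unique (arcsWhere G)
arcsWhere-unique G = Uniqueₚ.filter⁺ (λ e → G (proj₁ e) (proj₂ e) Boolₚ.≟ true) (pairs-unique _)

module Cut {T : Digraph n} (tour : Tournament T) (ord : Ordering T) where
  open Ordering ord

  backward : ℕ → Fin n → Fin n → Bool
  backward c y x = T y x ∧ (does (pos x <? c) ∧ does (c ≤? pos y))

  cutArcs : ℕ → List (Fin n × Fin n)
  cutArcs c = arcsWhere (backward c)

  backward⁺ : ∀ {c x y} → Arc T y x → pos x < c → c ≤ pos y → (y , x) ∈ cutArcs c
  backward⁺ {c} {x} {y} a lt le = ∈-arcsWhere⁺ (backward c)
    (∧-intro a (∧-intro (dec-true (pos x <? c) lt) (dec-true (c ≤? pos y) le)))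

  backward⁻ : ∀ {c x y} → backward c y x ≡ true → Arc T y x × pos x < c × c ≤ pos y
  backward⁻ {c} {x} {y} p = ∧-fst {T y x} p ,
    does-true (pos x <? c) (∧-fst (∧-snd {T y x} p)) ,
    does-true (c ≤? pos y) (∧-snd {does (pos x <? c)} (∧-snd {T y x} p))

  cut-empty : ∀ c → n ≤ c → length (cutArcs c) ≤ 0
  cut-empty c n≤c = unique-⊆-length {ys = []} (arcsWhere-unique (backward c))
    (λ {e} e∈ → contradiction (<-≤-trans (pos<n (proj₁ e)) n≤c)
      (≤⇒≯ (proj₂ (proj₂ (backward⁻ (∈-arcsWhere⁻ (backward c) e∈))))))

  -- The backward arcs form a subset of tails times heads, so if both sets are small, so is the cut.
  -- The outdegree of the vertex `v` at position `c` separates them: heads precede `v` and have at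
  -- least its outdegree, tails at most. Many tails are handled as many heads in the reversed
  -- tournament.
  cut-small : ∀ (m h c : ℕ) →
    RobustFamily T m h ⊎ length (cutArcs c) ≤ (21 * m + 18 + 2 * h) * (21 * m + 18 + 2 * h)
  cut-small m h c with c <? n
  ... | no c≮n = inj₂ (≤-trans (cut-empty c (≮⇒≥ c≮n)) z≤n)
  ... | yes c<n with pos-surj c<n
  ...   | v , pos-v with 21 * m + 18 + 2 * h ≤? # heads | 21 * m + 18 + 2 * h ≤? # tails
    where
    heads tails : Fin n → Bool
    heads x = does (Finₚ.any? (λ y → backward c y x Boolₚ.≟ true))
    tails y = does (Finₚ.any? (λ x → backward c y x Boolₚ.≟ true))
  ...     | yes big | _ = inj₁ (heads⇒robust tour _ (outdeg T v) m h partner big)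
    where
    partner : ∀ x → does (Finₚ.any? (λ y → backward c y x Boolₚ.≟ true)) ≡ true →
      outdeg T v ≤ outdeg T x × Σ (Fin n) λ y → Arc T y x × outdeg T y ≤ outdeg T v
    partner x p with does-true (Finₚ.any? (λ y → backward c y x Boolₚ.≟ true)) p
    ... | y , b with backward⁻ b
    ...   | yx , x< , y≥ = pos-deg (<-≤-trans x< (≤-reflexive (sym pos-v))) , y , yx , deg-≤
      where
      deg-≤ : outdeg T y ≤ outdeg T v
      deg-≤ with m≤n⇒m<n∨m≡n y≥
      ... | inj₁ lt = pos-deg (subst (_< pos y) (sym pos-v) lt)
      ... | inj₂ eq = ≤-reflexive (cong (outdeg T) (pos-inj (trans (sym eq) (sym pos-v))))
  ...     | no _ | yes big = inj₁ (robustFamily-op {G = T}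
      (heads⇒robust (op-tournament tour) _ (indeg T v) m h partner big))
    where
    partner : ∀ y → does (Finₚ.any? (λ x → backward c y x Boolₚ.≟ true)) ≡ true →
      indeg T v ≤ indeg T y × Σ (Fin n) λ x → Arc T y x × indeg T x ≤ indeg T v
    partner y p with does-true (Finₚ.any? (λ x → backward c y x Boolₚ.≟ true)) p
    ... | x , b with backward⁻ b
    ...   | yx , x< , y≥ = flip-≤ deg-≤ , x , yx ,
        flip-≤ (pos-deg (<-≤-trans x< (≤-reflexive (sym pos-v))))
      where
      flip-≤ : ∀ {a b} → outdeg T a ≤ outdeg T b → indeg T b ≤ indeg T a
      flip-≤ {a} {b} le = ≤-trans (indeg-close tour {a} {b} {0} (≤-trans le (≤-reflexive (sym (+-identityʳ _)))))
        (≤-reflexive (+-identityʳ _))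
      deg-≤ : outdeg T y ≤ outdeg T v
      deg-≤ with m≤n⇒m<n∨m≡n y≥
      ... | inj₁ lt = pos-deg (subst (_< pos y) (sym pos-v) lt)
      ... | inj₂ eq = ≤-reflexive (cong (outdeg T) (pos-inj (trans (sym eq) (sym pos-v))))
  ...     | no fewH | no fewT = inj₂ (begin
    length (cutArcs c)
      ≤⟨ unique-⊆-length (arcsWhere-unique (backward c)) sub ⟩
    length (cartesianProduct (elems tails) (elems heads))
      ≡⟨ length-cartesianProduct (elems tails) (elems heads) ⟩
    length (elems tails) * length (elems heads)
      ≡⟨ cong₂ _*_ (length-elems tails) (length-elems heads) ⟩
    # tails * # heads
      ≤⟨ *-mono-≤ (<⇒≤ (≰⇒> fewT)) (<⇒≤ (≰⇒> fewH)) ⟩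
    (21 * m + 18 + 2 * h) * (21 * m + 18 + 2 * h) ∎)
    where
    open ≤-Reasoning
    heads tails : Fin n → Bool
    heads x = does (Finₚ.any? (λ y → backward c y x Boolₚ.≟ true))
    tails y = does (Finₚ.any? (λ x → backward c y x Boolₚ.≟ true))
    sub : ∀ {e} → e ∈ cutArcs c → e ∈ cartesianProduct (elems tails) (elems heads)
    sub {y , x} e∈ = ∈-cartesianProduct⁺
      (∈-elems⁺ tails (dec-true (Finₚ.any? (λ x → backward c y x Boolₚ.≟ true)) (x , ∈-arcsWhere⁻ (backward c) e∈)))
      (∈-elems⁺ heads (dec-true (Finₚ.any? (λ y → backward c y x Boolₚ.≟ true)) (y , ∈-arcsWhere⁻ (backward c) e∈)))

  cuts-small : ∀ (m h : ℕ) →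
    RobustFamily T m h ⊎ (∀ c → length (cutArcs c) ≤ (21 * m + 18 + 2 * h) * (21 * m + 18 + 2 * h))
  cuts-small m h = go (below n)
    where
    w = (21 * m + 18 + 2 * h) * (21 * m + 18 + 2 * h)
    below : ∀ d → RobustFamily T m h ⊎ (∀ c → c < d → length (cutArcs c) ≤ w)
    below zero = inj₂ λ _ ()
    below (suc d) with below d | cut-small m h d
    ... | inj₁ r | _      = inj₁ r
    ... | inj₂ _ | inj₁ r = inj₁ r
    ... | inj₂ p | inj₂ q = inj₂ both
      where
      both : ∀ c → c < suc d → length (cutArcs c) ≤ w
      both c (s≤s c≤d) with m≤n⇒m<n∨m≡n c≤d
      ... | inj₁ c<d  = p c c<d
      ... | inj₂ refl = q
    go : RobustFamily T m h ⊎ (∀ c → c < n → length (cutArcs c) ≤ w) →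
      RobustFamily T m h ⊎ (∀ c → length (cutArcs c) ≤ w)
    go (inj₁ r) = inj₁ r
    go (inj₂ p) = inj₂ all
      where
      all : ∀ c → length (cutArcs c) ≤ w
      all c with c <? n
      ... | yes c<n = p c c<n
      ... | no c≮n  = ≤-trans (cut-empty c (≮⇒≥ c≮n)) z≤n

-- Walks, paths and bounded search

castWalk : {G : Digraph n} {x x′ y y′ : Fin n} → x ≡ x′ → y ≡ y′ → Walk G x y → Walk G x′ y′
castWalk refl refl w = w

arcs-castWalk : {G : Digraph n} {x x′ y y′ : Fin n} (p : x ≡ x′) (q : y ≡ y′) (w : Walk G x y) →
  arcs (castWalk p q w) ≡ arcs w
arcs-castWalk refl refl w = refl

mapWalk : {G G′ : Digraph n} → (∀ x y → Arc G x y → Arc G′ x y) → ∀ {x y} → Walk G x y → Walk G′ x y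
mapWalk f stop       = stop
mapWalk f (step a w) = step (f _ _ a) (mapWalk f w)

arcs-mapWalk : {G G′ : Digraph n} (f : ∀ x y → Arc G x y → Arc G′ x y) → ∀ {x y} (w : Walk G x y) →
  arcs (mapWalk {G′ = G′} f w) ≡ arcs w
arcs-mapWalk f stop       = refl
arcs-mapWalk f (step a w) = cong (_ ∷_) (arcs-mapWalk f w)

arcs-are-arcs : {G : Digraph n} {x y : Fin n} (w : Walk G x y) → ∀ {e} → e ∈ arcs w → Arc G (proj₁ e) (proj₂ e)
arcs-are-arcs (step a w) (here refl) = a
arcs-are-arcs (step a w) (there e∈)  = arcs-are-arcs w e∈

suffix : {G : Digraph n} {x y z : Fin n} (w : Walk G x z) → y ∈ vertices w →
  Σ (Walk G y z) λ w′ → (IsPath w → IsPath w′) × (∀ {e} → e ∈ arcs w′ → e ∈ arcs w)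
suffix w@stop       (here refl) = w , id , id
suffix w@(step _ _) (here refl) = w , id , id
suffix (step a w)   (there y∈) with suffix w y∈
... | w′ , path , sub = w′ , (λ { (_ AP.∷ u) → path u }) , there ∘ sub

-- Cutting out closed parts only drops arcs, so arc-disjointness survives. Constructions can
-- therefore work with walks and pass to paths at the end.
toPath : {G : Digraph n} {x y : Fin n} (w : Walk G x y) →
  Σ (Walk G x y) λ w′ → IsPath w′ × (∀ {e} → e ∈ arcs w′ → e ∈ arcs w)
toPath stop = stop , [] AP.∷ AP.[] , id
toPath (step {x} a w) with toPath w
... | w′ , path , sub with x ∈? vertices w′
...   | yes x∈ with suffix w′ x∈
...     | w″ , path″ , sub″ = w″ , path″ path , there ∘ sub ∘ sub″
toPath (step {x} a w) | w′ , path , sub | no x∉ = step a w′ , All.tabulate (λ { y∈ refl → x∉ y∈ }) AP.∷ path ,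
  λ { (here eq) → here eq ; (there e∈) → there (sub e∈) }

path-length : {G : Digraph n} {x y : Fin n} (w : Walk G x y) → IsPath w → length (arcs w) ≤ n
path-length {n} w path = <⇒≤ (subst (_≤ n) (length-vertices w)
  (≤-trans (unique-⊆-length path (λ {x} _ → ∈-allFin x)) (≤-reflexive (length-tabulate {n = n} id))))
  where
  length-vertices : ∀ {G : Digraph n} {x y} (w : Walk G x y) → length (vertices w) ≡ suc (length (arcs w))
  length-vertices stop       = refl
  length-vertices (step _ w) = cong suc (length-vertices w)

-- The predicate `P` may itself contain a search; in `system?` it searches for all remaining walks,
-- which gives backtracking.
anyWalk? : {G : Digraph n} (b : ℕ) {x y : Fin n} {P : Walk G x y → Set} → (∀ w → Dec (P w)) →
  Dec (Σ (Walk G x y) λ w → length (arcs w) ≤ b × P w)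
anyWalk? {G = G} b {x} {y} {P} P? with trivial?
  where
  trivial? : Dec (Σ (Walk G x y) λ w → length (arcs w) ≡ 0 × P w)
  trivial? with x Finₚ.≟ y
  ... | no x≢y = no λ { (stop , _) → x≢y refl }
  ... | yes refl = map′ (λ p → stop , refl , p) (λ { (stop , _ , p) → p }) (P? stop)
anyWalk? b P? | yes (w , eq , p) = yes (w , ≤-trans (≤-reflexive eq) z≤n , p)
anyWalk? zero P? | no none = no λ { (stop , le , p) → none (stop , refl , p) }
anyWalk? {G = G} (suc b) {x} {y} {P} P? | no none with Finₚ.any? first?
  where
  First : Fin _ → Set
  First z = Σ (Arc G x z) λ a → Σ (Walk G z y) λ w → length (arcs w) ≤ b × P (step a w)
  first? : ∀ z → Dec (First z)
  first? z with G x z Boolₚ.≟ true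
  ... | no ¬a = no (¬a ∘ proj₁)
  ... | yes a = map′ (a ,_)
    (λ { (a′ , r) → subst (λ a → Σ (Walk G z y) λ w → length (arcs w) ≤ b × P (step a w)) (uip a′ a) r })
    (anyWalk? b (P? ∘ step a))
... | yes (z , a , w , le , p) = yes (step a w , s≤s le , p)
... | no none′ = no λ { (stop , le , p) → none (stop , refl , p)
                      ; (step a w , s≤s le , p) → none′ (_ , a , w , le , p) }

-- Systems of arc-disjoint walks

_∈ᵉ?_ : (e : Fin n × Fin n) (es : List (Fin n × Fin n)) → Dec (e ∈ es)
e ∈ᵉ? es = Any.any? (≡-dec Finₚ._≟_ Finₚ._≟_ e) es

module _ (G : Digraph n) {A : Set} (s t : A → Fin n) (b : ℕ) where

  -- Each walk avoids the arcs used so far, so pairwise disjointness is built up one walk at a time.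
  -- This suits both the backtracking search and the greedy routing.
  data System : List A → List (Fin n × Fin n) → Set where
    []   : ∀ {used} → System [] used
    cons : ∀ {a as used} (w : Walk G (s a) (t a)) → length (arcs w) ≤ b → All (_∉ used) (arcs w) →
      System as (arcs w ++ used) → System (a ∷ as) used

module _ {G : Digraph n} {A : Set} {s t : A → Fin n} {b : ℕ} where

  systemWalk : ∀ {as used a} → System G s t b as used → a ∈ as → Walk G (s a) (t a)
  systemWalk (cons w _ _ _) (here refl) = w
  systemWalk (cons _ _ _ S) (there a∈)  = systemWalk S a∈

  systemWalk-unused : ∀ {as used a} (S : System G s t b as used) (a∈ : a ∈ as) →
    ∀ {e} → e ∈ arcs (systemWalk S a∈) → e ∉ used
  systemWalk-unused (cons w _ un _) (here refl) e∈ = All.lookup un e∈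
  systemWalk-unused (cons w _ _ S)  (there a∈)  e∈ = systemWalk-unused S a∈ e∈ ∘ ∈-++⁺ʳ (arcs w)

  systemWalk-disjoint : ∀ {as used a a′} (S : System G s t b as used) (a∈ : a ∈ as) (a′∈ : a′ ∈ as) →
    a ≢ a′ → ∀ {e} → e ∈ arcs (systemWalk S a∈) → e ∉ arcs (systemWalk S a′∈)
  systemWalk-disjoint (cons w _ _ S) (here refl) (here refl) a≢ = contradiction refl a≢
  systemWalk-disjoint (cons w _ _ S) (here refl) (there a′∈) a≢ e∈ e∈′ = systemWalk-unused S a′∈ e∈′ (∈-++⁺ˡ e∈)
  systemWalk-disjoint (cons w _ _ S) (there a∈)  (here refl) a≢ e∈ e∈′ = systemWalk-unused S a∈ e∈ (∈-++⁺ˡ e∈′)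
  systemWalk-disjoint (cons w _ _ S) (there a∈)  (there a′∈) a≢ = systemWalk-disjoint S a∈ a′∈ a≢

  system? : ∀ as used → Dec (System G s t b as used)
  system? []       used = yes []
  system? (a ∷ as) used = map′ (λ { (w , le , un , S) → cons w le un S })
    (λ { (cons w le un S) → w , le , un , S })
    (anyWalk? b (λ w → All.all? (λ e → ¬? (e ∈ᵉ? used)) (arcs w) ×-dec system? as (arcs w ++ used)))

-- Pieces of an immersion

infixl 30 _↾_
_↾_ : Digraph n → (Fin n → Bool) → Digraph n
(G ↾ A) x y = G x y ∧ (A x ∧ A y)

↾⁺ : {G : Digraph n} (A : Fin n → Bool) {x y : Fin n} → Arc G x y → A x ≡ true → A y ≡ true → Arc (G ↾ A) x y
↾⁺ A a Ax Ay = ∧-intro a (∧-intro Ax Ay)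

↾⁻ : {G : Digraph n} (A : Fin n → Bool) {x y : Fin n} → Arc (G ↾ A) x y → Arc G x y × A x ≡ true × A y ≡ true
↾⁻ {G = G} A {x} {y} a = ∧-fst {G x y} a , ∧-fst {A x} (∧-snd {G x y} a) , ∧-snd {A x} (∧-snd {G x y} a)

full : Fin n → Bool
full _ = true

-- The values of ψ outside S are junk.
record Piece (G : Digraph n) (H : Digraph h) (A : Fin n → Bool) (S : Fin h → Bool) : Set where
  field
    ψ             : Fin h → Fin n
    ψ∈            : ∀ u → S u ≡ true → A (ψ u) ≡ true
    ψ-inj         : ∀ u v → S u ≡ true → S v ≡ true → ψ u ≡ ψ v → u ≡ v
    link          : ∀ u v → Arc (H ↾ S) u v → Walk G (ψ u) (ψ v)
    link-disjoint : ∀ u v p u′ v′ p′ → (u , v) ≢ (u′ , v′) →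
      ∀ {e} → e ∈ arcs (link u v p) → e ∉ arcs (link u′ v′ p′)

open Piece public

module _ {G G′ : Digraph n} {H : Digraph h} {A A′ : Fin n → Bool} {S S′ : Fin h → Bool} where

  piece-mono : (∀ x y → Arc G x y → Arc G′ x y) → (∀ x → A x ≡ true → A′ x ≡ true) →
    (∀ u → S′ u ≡ true → S u ≡ true) → Piece G H A S → Piece G′ H A′ S′
  piece-mono G⊆ A⊆ S⊆ p = record
    { ψ     = ψ p
    ; ψ∈    = λ u Su → A⊆ _ (ψ∈ p u (S⊆ u Su))
    ; ψ-inj = λ u v Su Sv → ψ-inj p u v (S⊆ u Su) (S⊆ v Sv)
    ; link  = λ u v a → mapWalk G⊆ (link p u v (sub a))
    ; link-disjoint = λ u v a u′ v′ a′ ne e∈ e∈′ →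
        link-disjoint p u v (sub a) u′ v′ (sub a′) ne
          (subst (_ ∈_) (arcs-mapWalk G⊆ (link p u v (sub a))) e∈)
          (subst (_ ∈_) (arcs-mapWalk G⊆ (link p u′ v′ (sub a′))) e∈′)
    }
    where
    sub : ∀ {u v} → Arc (H ↾ S′) u v → Arc (H ↾ S) u v
    sub {u} {v} a with ↾⁻ {G = H} S′ {u} {v} a
    ... | uv , Su , Sv = ↾⁺ {G = H} S uv (S⊆ u Su) (S⊆ v Sv)

module _ {G : Digraph n} {H : Digraph h} where

  full⁺ : ∀ {u v} → Arc H u v → Arc (H ↾ full) u v
  full⁺ a = ↾⁺ {G = H} full a refl refl

  fromPiece : Piece G H full full → Immersion G H
  fromPiece p = record
    { φ              = ψ p
    ; φ-inj          = λ u v → ψ-inj p u v refl refl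
    ; route          = λ u v a → proj₁ (toPath (link p u v (full⁺ a)))
    ; route-path     = λ u v a → proj₁ (proj₂ (toPath (link p u v (full⁺ a))))
    ; route-disjoint = λ u v a u′ v′ a′ ne e e∈ e∈′ →
        link-disjoint p u v (full⁺ a) u′ v′ (full⁺ a′) ne
          (proj₂ (proj₂ (toPath (link p u v (full⁺ a)))) e∈)
          (proj₂ (proj₂ (toPath (link p u′ v′ (full⁺ a′)))) e∈′)
    }

  fromPiece-uses : (p : Piece G H full full) → ∀ {e} → UsesArc (fromPiece p) e →
    Σ (Fin h) λ u → Σ (Fin h) λ v → Σ (Arc (H ↾ full) u v) λ a → e ∈ arcs (link p u v a)
  fromPiece-uses p (u , v , a , e∈) = u , v , full⁺ a , proj₂ (proj₂ (toPath (link p u v (full⁺ a)))) e∈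

  toPiece : Immersion G H → Piece G H full full
  toPiece M = record
    { ψ     = φ M
    ; ψ∈    = λ _ _ → refl
    ; ψ-inj = λ u v _ _ → φ-inj M u v
    ; link  = λ u v a → route M u v (∧-fst a)
    ; link-disjoint = λ u v a u′ v′ a′ ne → route-disjoint M u v (∧-fst a) u′ v′ (∧-fst a′) ne _
    }

-- Deciding the existence of a piece

functions : {A : Set} → List A → ∀ h → List (Fin h → A)
functions xs zero    = VF.[] ∷ []
functions xs (suc h) = concatMap (λ x → map (x VF.∷_) (functions xs h)) xs

-- A function is found in the list only up to pointwise equality; `complete` and `canonical`
-- therefore work with a listed double.
functions-complete : {A : Set} (xs : List A) → (∀ x → x ∈ xs) → ∀ h (f : Fin h → A) →
  Σ (Fin h → A) λ g → g ∈ functions xs h × (∀ i → g i ≡ f i)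
functions-complete xs all zero    f = VF.[] , here refl , λ ()
functions-complete xs all (suc h) f with functions-complete xs all h (f ∘ suc)
... | g , g∈ , eq = f zero VF.∷ g ,
  ∈-concatMap⁺ _ {xs = xs} (Any.map (λ { refl → ∈-map⁺ (f zero VF.∷_) g∈ }) (all (f zero))) ,
  λ { zero → refl ; (suc i) → eq i }

module _ (G : Digraph n) (H : Digraph h) (A : Fin n → Bool) (S : Fin h → Bool) where
  private
    labels : List (Fin h × Fin h)
    labels = arcsWhere (H ↾ S)

    Realises : (Fin h → Fin n) → Set
    Realises g = (∀ u → S u ≡ true → A (g u) ≡ true)
      × (∀ u v → S u ≡ true → S v ≡ true → g u ≡ g v → u ≡ v)
      × System G (g ∘ proj₁) (g ∘ proj₂) n labels []

    realises? : ∀ g → Dec (Realises g)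
    realises? g = Finₚ.all? (λ u → (S u Boolₚ.≟ true) →-dec (A (g u) Boolₚ.≟ true))
      ×-dec Finₚ.all? (λ u → Finₚ.all? (λ v → (S u Boolₚ.≟ true) →-dec ((S v Boolₚ.≟ true) →-dec ((g u Finₚ.≟ g v) →-dec (u Finₚ.≟ v)))))
      ×-dec system? labels []

    sound : ∀ g → Realises g → Piece G H A S
    sound g (g∈ , inj , sys) = record
      { ψ = g ; ψ∈ = g∈ ; ψ-inj = inj
      ; link = λ u v a → systemWalk sys (∈-arcsWhere⁺ (H ↾ S) a)
      ; link-disjoint = λ u v a u′ v′ a′ → systemWalk-disjoint sys (∈-arcsWhere⁺ (H ↾ S) a) (∈-arcsWhere⁺ (H ↾ S) a′)
      }

    complete : (p : Piece G H A S) (g : Fin h → Fin n) → (∀ u → g u ≡ ψ p u) → Realises g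
    complete p g eq = (λ u Su → subst (λ x → A x ≡ true) (sym (eq u)) (ψ∈ p u Su))
      , (λ u v Su Sv gu≡gv → ψ-inj p u v Su Sv (trans (sym (eq u)) (trans gu≡gv (eq v))))
      , build labels [] (arcsWhere-unique (H ↾ S)) (λ e∈ → ∈-arcsWhere⁻ (H ↾ S) e∈) (λ _ _ ())
      where
      path : ∀ u v → Arc (H ↾ S) u v → Walk G (g u) (g v)
      path u v a = castWalk (sym (eq u)) (sym (eq v)) (proj₁ (toPath (link p u v a)))
      arcs-path : ∀ u v a → arcs (path u v a) ≡ arcs (proj₁ (toPath (link p u v a)))
      arcs-path u v a = arcs-castWalk (sym (eq u)) (sym (eq v)) _
      path-sub : ∀ u v a {e} → e ∈ arcs (path u v a) → e ∈ arcs (link p u v a)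
      path-sub u v a e∈ = proj₂ (proj₂ (toPath (link p u v a))) (subst (_ ∈_) (arcs-path u v a) e∈)
      build : ∀ as used → Unique as → (∀ {e} → e ∈ as → Arc (H ↾ S) (proj₁ e) (proj₂ e)) →
        (∀ {e} → e ∈ as → ∀ a {x} → x ∈ used → x ∉ arcs (path (proj₁ e) (proj₂ e) a)) →
        System G (g ∘ proj₁) (g ∘ proj₂) n as used
      build [] used _ _ _ = []
      build ((u , v) ∷ as) used (u∉ AP.∷ uniq) ok fresh = cons (path u v a)
        (subst (_≤ n) (cong length (sym (arcs-path u v a)))
          (path-length (proj₁ (toPath (link p u v a))) (proj₁ (proj₂ (toPath (link p u v a))))))
        (All.tabulate (λ x∈ x∈used → fresh (here refl) a x∈used x∈))
        (build as (arcs (path u v a) ++ used) uniq (ok ∘ there) fresh′)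
        where
        a = ok (here refl)
        fresh′ : ∀ {e} → e ∈ as → ∀ a′ {x} → x ∈ arcs (path u v a) ++ used → x ∉ arcs (path (proj₁ e) (proj₂ e) a′)
        fresh′ {e} e∈ a′ x∈ x∈′ with ∈-++⁻ (arcs (path u v a)) x∈
        ... | inj₂ x∈used = fresh (there e∈) a′ x∈used x∈′
        ... | inj₁ x∈path = link-disjoint p u v a (proj₁ e) (proj₂ e) a′ (All.lookup u∉ e∈)
          (path-sub u v a x∈path) (path-sub (proj₁ e) (proj₂ e) a′ x∈′)

  -- The search is finite: there are finitely many maps on branch vertices, and links of at most `n`
  -- arcs suffice because every link can be shortened to a path.
  piece? : Dec (Piece G H A S)
  piece? with Any.any? realises? (functions (allFin n) h)
  ... | yes found = let g , r = Any.satisfied found in yes (sound g r)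
  ... | no none = no refute
    where
    refute : ¬ Piece G H A S
    refute p with functions-complete (allFin n) ∈-allFin h (ψ p)
    ... | g , g∈ , eq = none (Any.map (λ { refl → complete p g eq }) g∈)

-- Packing immersions into a robust family

-- Copies need only be arc-disjoint, so all `k` of them share the branch vertices `f`. At most
-- `k * (h * h)` links are routed, and each adds at most 4 arcs with 8 ends to the forbidden
-- vertices.
robust⇒packing : (T : Digraph n) (H : Digraph h) (k m : ℕ) → 8 * (k * (h * h)) ≤ m →
  RobustFamily T m h → DisjointImmersions k T H
robust⇒packing {n} {h} T H k m m≥ (f , inj , robust) = M , disjoint
  where
  Label = Fin k × (Fin h × Fin h)
  s t : Label → Fin n
  s (_ , u , _) = f u
  t (_ , _ , v) = f v
  labels : List Label
  labels = cartesianProduct (allFin k) (arcsWhere H)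
  labels-length : length labels ≤ k * (h * h)
  labels-length = begin
    length labels                                ≡⟨ length-cartesianProduct (allFin k) (arcsWhere H) ⟩
    length (allFin k) * length (arcsWhere H)     ≤⟨ *-mono-≤ (≤-reflexive (length-tabulate {n = k} id)) (length-filter _ (pairs h)) ⟩
    k * length (pairs h)                         ≡⟨ cong (k *_) (trans (length-cartesianProduct (allFin h) (allFin h)) (cong₂ _*_ (length-tabulate {n = h} id) (length-tabulate {n = h} id))) ⟩
    k * (h * h)                                  ∎
    where open ≤-Reasoning
  -- Invariant: the ends of the used arcs, plus 8 for each link still to be routed, stay within the
  -- budget `m`.
  greedy : ∀ as used → 2 * length used + 8 * length as ≤ m → System T s t 4 as used
  greedy [] used le = []
  greedy ((i , u , v) ∷ as) used le with robust u v (map proj₁ used ++ map proj₂ used) ends≤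
    where
    ends≤ : length (map proj₁ used ++ map proj₂ used) ≤ m
    ends≤ = begin
      length (map proj₁ used ++ map proj₂ used)          ≡⟨ length-++ (map proj₁ used) ⟩
      length (map proj₁ used) + length (map proj₂ used)  ≡⟨ cong₂ _+_ (length-map proj₁ used) (trans (length-map proj₂ used) (sym (+-identityʳ _))) ⟩
      2 * length used                                    ≤⟨ m≤m+n _ _ ⟩
      2 * length used + 8 * suc (length as)              ≤⟨ le ⟩
      m                                                  ∎
      where open ≤-Reasoning
  ... | w , short , avoids = cons w short (All.map fresh avoids) (greedy as (arcs w ++ used) next≤)
    where
    fresh : ∀ {e} → Avoids (map proj₁ used ++ map proj₂ used) e → e ∉ used
    fresh (inj₁ end∉) e∈ = end∉ (∈-++⁺ˡ (∈-map⁺ proj₁ e∈))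
    fresh (inj₂ end∉) e∈ = end∉ (∈-++⁺ʳ (map proj₁ used) (∈-map⁺ proj₂ e∈))
    next≤ : 2 * length (arcs w ++ used) + 8 * length as ≤ m
    next≤ = begin
      2 * length (arcs w ++ used) + 8 * length as              ≡⟨ cong (λ l → 2 * l + 8 * length as) (length-++ (arcs w)) ⟩
      2 * (length (arcs w) + length used) + 8 * length as      ≤⟨ +-monoˡ-≤ (8 * length as) (*-monoʳ-≤ 2 (+-monoˡ-≤ (length used) short)) ⟩
      2 * (4 + length used) + 8 * length as                    ≡⟨ rearrange (length used) (length as) ⟩
      2 * length used + 8 * suc (length as)                    ≤⟨ le ⟩
      m                                                        ∎
      where
      open ≤-Reasoning
      rearrange : ∀ a b → 2 * (4 + a) + 8 * b ≡ 2 * a + 8 * suc b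
      rearrange = solve-∀
  sys : System T s t 4 labels []
  sys = greedy labels [] (≤-trans (*-monoʳ-≤ 8 labels-length) m≥)
  label∈ : ∀ i {u v} → Arc (H ↾ full) u v → (i , u , v) ∈ labels
  label∈ i a = ∈-cartesianProduct⁺ (∈-allFin i) (∈-arcsWhere⁺ H (∧-fst a))
  P : Fin k → Piece T H full full
  P i = record
    { ψ = f ; ψ∈ = λ _ _ → refl ; ψ-inj = λ u v _ _ → inj u v
    ; link = λ u v a → systemWalk sys (label∈ i a)
    ; link-disjoint = λ u v a u′ v′ a′ ne → systemWalk-disjoint sys (label∈ i a) (label∈ i a′) (ne ∘ cong proj₂)
    }
  M : Fin k → Immersion T H
  M i = fromPiece (P i)
  disjoint : ∀ i j → i ≢ j → ∀ e → UsesArc (M i) e → ¬ UsesArc (M j) e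
  disjoint i j i≢j e ue ue′ with fromPiece-uses (P i) ue | fromPiece-uses (P j) ue′
  ... | u , v , a , e∈ | u′ , v′ , a′ , e∈′ =
    systemWalk-disjoint sys (label∈ i a) (label∈ j a′) (i≢j ∘ cong proj₁) e∈ e∈′

-- Minimal intervals and the cuts next to their ends

subsets : ∀ h → List (Fin h → Bool)
subsets h = functions (true ∷ false ∷ []) h

Nontrivial : ∀ {h} → (Fin h → Bool) → Set
Nontrivial {h} S = Σ (Fin h) λ u → Σ (Fin h) λ v → u ≢ v × S u ≡ true × S v ≡ true

-- Number of cuts, in units of `N`, for all sequences of `q` sets: each candidate for the first set
-- needs two cuts per interval and then its own continuation from the end of its run.
cutCost : ℕ → ℕ → ℕ
cutCost h zero    = 0
cutCost h (suc q) = length (subsets h) * (2 + cutCost h q)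

module Intervals {n h : ℕ} {T : Digraph n} (ord : Ordering T) (H : Digraph h) where
  open Ordering ord

  interval : ℕ → ℕ → Fin n → Bool
  interval lo hi v = does (lo ≤? pos v) ∧ does (pos v <? hi)

  interval⁺ : ∀ {lo hi v} → lo ≤ pos v → pos v < hi → interval lo hi v ≡ true
  interval⁺ {lo} {hi} {v} le lt = ∧-intro (dec-true (lo ≤? pos v) le) (dec-true (pos v <? hi) lt)

  interval⁻ : ∀ {lo hi v} → interval lo hi v ≡ true → lo ≤ pos v × pos v < hi
  interval⁻ {lo} {hi} {v} p = does-true (lo ≤? pos v) (∧-fst p) ,
    does-true (pos v <? hi) (∧-snd {does (lo ≤? pos v)} p)

  Hold : (Fin n → Bool) → (Fin h → Bool) → Set
  Hold A S = Piece (T ↾ A) H A S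

  hold-mono : ∀ {A A′ S S′} → (∀ x → A x ≡ true → A′ x ≡ true) → (∀ u → S′ u ≡ true → S u ≡ true) →
    Hold A S → Hold A′ S′
  hold-mono {A} {A′} A⊆ S⊆ = piece-mono
    (λ x y a → let xy , Ax , Ay = ↾⁻ {G = T} A {x} {y} a in ↾⁺ {G = T} A′ xy (A⊆ x Ax) (A⊆ y Ay)) A⊆ S⊆

  -- A lies in a block, starting at l, of the positions cut at P.
  Uncut : List ℕ → ℕ → (Fin n → Bool) → Set
  Uncut P l A = ∀ v → A v ≡ true → l ≤ pos v × (∀ {c} → c ∈ P → l < c → pos v < c)

  uncut-⊆ : ∀ {P P′ l A} → (∀ {c} → c ∈ P′ → c ∈ P) → Uncut P l A → Uncut P′ l A
  uncut-⊆ sub un v Av = proj₁ (un v Av) , λ c∈ → proj₂ (un v Av) (sub c∈)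

  -- Failure at length `j - 1` expresses minimality, as holding is monotone in the interval. Length
  -- `n` reaches past all positions.
  next : ∀ S s → (Σ ℕ λ j → Hold (interval s (s + j)) S × (∀ {j′} → j ≡ suc j′ → ¬ Hold (interval s (s + j′)) S))
    ⊎ ¬ Hold (interval s (s + n)) S
  next S s = go n
    where
    go : ∀ d → (Σ ℕ λ j → Hold (interval s (s + j)) S × (∀ {j′} → j ≡ suc j′ → ¬ Hold (interval s (s + j′)) S))
      ⊎ ¬ Hold (interval s (s + d)) S
    go d with piece? (T ↾ interval s (s + d)) H (interval s (s + d)) S
    ... | no none = inj₂ none
    go zero    | yes p = inj₁ (0 , p , λ ())
    go (suc d) | yes p with go d
    ... | inj₁ found = inj₁ found
    ... | inj₂ none  = inj₁ (suc d , p , λ { refl → none })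

  -- Cutting at s + j and s + j − 1, where [s , s + j) is a minimal interval holding S, leaves
  -- only intervals not holding S and a single vertex before s + j.
  past-next : ∀ {S s j P A l} → (∀ {j′} → j ≡ suc j′ → ¬ Hold (interval s (s + j′)) S) →
    s + j ∈ P → (∀ {j′} → j ≡ suc j′ → s + j′ ∈ P) →
    s ≤ l → Uncut P l A → Nontrivial S → Hold A S → s + j ≤ l
  past-next {s = s} {j = zero} _ _ _ s≤l _ _ _ = subst (_≤ _) (sym (+-identityʳ s)) s≤l
  past-next {S} {s} {suc j} {P} {A} {l} minimal c∈ c′∈ s≤l un (u , v , u≢v , Su , Sv) p with s + suc j ≤? l
  ... | yes le = le
  ... | no ≰l with l <? s + j
  ...   | yes l< = contradiction
    (hold-mono (λ x Ax → interval⁺ (≤-trans s≤l (proj₁ (un x Ax))) (proj₂ (un x Ax) (c′∈ refl) l<)) (λ _ → id) p)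
    (minimal refl)
  ...   | no l≮ = contradiction (ψ-inj p u v Su Sv (pos-inj (trans (at u Su) (sym (at v Sv))))) u≢v
    where
    at : ∀ u → S u ≡ true → pos (ψ p u) ≡ s + j
    at u Su with un _ (ψ∈ p u Su)
    ... | l≤ , cut = ≤-antisym
      (≤-pred (subst (suc (pos (ψ p u)) ≤_) (+-suc s j) (cut c∈ (≰⇒> ≰l))))
      (≤-trans (≮⇒≥ l≮) l≤)

  Fails : List ℕ → (Fin h → Bool) → ℕ → Set
  Fails P S s = ∀ {A l} → s ≤ l → Uncut P l A → Nontrivial S → ¬ Hold A S

  -- By `beyond`, the `a` intervals precede every uncut block that holds `S`. The scan for the next
  -- set can thus start at `end a` without passing the block of the first.
  record Run (a : ℕ) (P : List ℕ) (S : Fin h → Bool) (s : ℕ) : Set where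
    field
      end      : ℕ → ℕ
      end-zero : end 0 ≡ s
      end-mono : ∀ i → end i ≤ end (suc i)
      holds    : ∀ i → i < a → Hold (interval (end i) (end (suc i))) S
      beyond   : ∀ {A l} → s ≤ l → Uncut P l A → Nontrivial S → Hold A S → end a ≤ l

  -- A search that fails at a later step still yields `Fails` from `s`: an uncut block holding `S`
  -- would lie past all the intervals found so far, where nothing holds `S`.
  run : ∀ a S s → Σ (List ℕ) λ P → length P ≤ 2 * a × (Fails P S s ⊎ Run a P S s)
  run zero S s = [] , z≤n , inj₂ (record
    { end = λ _ → s ; end-zero = refl ; end-mono = λ _ → ≤-refl ; holds = λ _ () ; beyond = λ s≤l _ _ _ → s≤l })
  run (suc a) S s with next S s
  ... | inj₂ none = [] , z≤n , inj₁ (λ s≤l un _ p → none (hold-mono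
      (λ x Ax → interval⁺ (≤-trans s≤l (proj₁ (un x Ax))) (≤-trans (pos<n x) (m≤n+m n s))) (λ _ → id) p))
  ... | inj₁ (j , p , minimal) with run a S (s + j)
  -- For `j = 0` both cuts are at `s`, and no earlier cut is needed.
  ...   | P , P≤ , rest = (s + j) ∷ (s + (j ∸ 1)) ∷ P ,
      ≤-trans (s≤s (s≤s P≤)) (≤-reflexive (sym (*-suc 2 a))) , extend rest
    where
    past : ∀ {A l} → s ≤ l → Uncut ((s + j) ∷ (s + (j ∸ 1)) ∷ P) l A → Nontrivial S → Hold A S → s + j ≤ l
    past = past-next minimal (here refl) (λ { refl → there (here refl) })
    extend : Fails P S (s + j) ⊎ Run a P S (s + j) →
      Fails ((s + j) ∷ (s + (j ∸ 1)) ∷ P) S s ⊎ Run (suc a) ((s + j) ∷ (s + (j ∸ 1)) ∷ P) S s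
    extend (inj₁ fails) = inj₁ (λ s≤l un nt q →
      fails (past s≤l un nt q) (uncut-⊆ (there ∘ there) un) nt q)
    extend (inj₂ r) = inj₂ (record
      { end = λ { zero → s ; (suc i) → end i }
      ; end-zero = refl
      ; end-mono = λ { zero → ≤-trans (m≤m+n s j) (≤-reflexive (sym end-zero)) ; (suc i) → end-mono i }
      ; holds = λ { zero _ → subst (λ t → Hold (interval s t) S) (sym end-zero) p ; (suc i) (s≤s lt) → holds i lt }
      ; beyond = λ s≤l un nt q → beyond (past s≤l un nt q) (uncut-⊆ (there ∘ there) un) nt q
      })
      where open Run r

  module Levels (N : ℕ) where

    -- Starts need not increase strictly: the intervals found for a block lie before it, so the same
    -- block can be used again at the next level. This is what permits borrowing.
    record Chain (P : List ℕ) (s : ℕ) : Set where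
      field
        set        : ℕ → Fin h → Bool
        set∈       : ∀ r → set r ∈ subsets h
        nontrivial : ∀ r → Nontrivial (set r)
        block      : ℕ → Fin n → Bool
        start      : ℕ → ℕ
        held       : ∀ r → Hold (block r) (set r)
        uncut      : ∀ r → Uncut P (start r) (block r)
        start-mono : ∀ r → start r ≤ start (suc r)
        start-≥    : s ≤ start 0

    open Chain

    tail : ∀ {P P′ s s′} (C : Chain P s) → (∀ {c} → c ∈ P′ → c ∈ P) → s′ ≤ start C 0 → Chain P′ s′
    tail C sub le = record
      { set = set C ∘ suc ; set∈ = set∈ C ∘ suc ; nontrivial = nontrivial C ∘ suc
      ; block = block C ∘ suc ; start = start C ∘ suc ; held = held C ∘ suc
      ; uncut = λ r → uncut-⊆ sub (uncut C (suc r))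
      ; start-mono = start-mono C ∘ suc ; start-≥ = ≤-trans le (start-mono C 0) }

    -- At level r, the N consecutive intervals between E r 0, …, E r N.
    record Grid (q s : ℕ) (Q : ℕ → (Fin n → Bool) → Set) : Set where
      field
        E       : ℕ → ℕ → ℕ
        E-mono  : ∀ r i → E r i ≤ E r (suc i)
        E-level : ∀ r → E r N ≤ E (suc r) 0
        E-start : s ≤ E 0 0
        E-holds : ∀ r i → r < q → i < N → Q r (interval (E r i) (E r (suc i)))

    private
      Solves : ℕ → ℕ → List ℕ → Set
      Solves q s P = (C : Chain P s) → Grid q s (λ r A → Hold A (set C r))

      -- Stated for all `P′` containing `P`, because the cuts of the different branches are finally
      -- united.
      Branch : ℕ → ℕ → List ℕ → (Fin h → Bool) → Set
      Branch q s P S = ∀ {P′} → (∀ {c} → c ∈ P → c ∈ P′) → (C : Chain P′ s) → S ≡ set C 0 →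
        Grid (suc q) s (λ r A → Hold A (set C r))

      gather : ∀ {Q : List ℕ → (Fin h → Bool) → Set} {b} → (∀ S → Σ (List ℕ) λ P → length P ≤ b × Q P S) →
        ∀ Ss → Σ (List ℕ) λ P → length P ≤ length Ss * b × (∀ {S} → S ∈ Ss → Σ (List ℕ) λ P′ → (∀ {c} → c ∈ P′ → c ∈ P) × Q P′ S)
      gather f [] = [] , z≤n , λ ()
      gather f (S ∷ Ss) with f S | gather f Ss
      ... | P₁ , le₁ , q₁ | P₂ , le₂ , q₂ = P₁ ++ P₂ ,
        ≤-trans (≤-reflexive (length-++ P₁)) (+-mono-≤ le₁ le₂) ,
        λ { (here refl) → P₁ , ∈-++⁺ˡ , q₁
          ; (there S∈) → let P′ , sub , q = q₂ S∈ in P′ , ∈-++⁺ʳ P₁ ∘ sub , q }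

      branch : ∀ q → (∀ s → Σ (List ℕ) λ P → length P ≤ N * cutCost h q × Solves q s P) →
        ∀ s S → Σ (List ℕ) λ P → length P ≤ N * (2 + cutCost h q) × Branch q s P S
      branch q later s S with run N S s
      ... | P , P≤ , inj₁ fails = P , ≤-trans P≤ bound , λ sub C → λ { refl →
          contradiction (held C 0) (fails (start-≥ C) (uncut-⊆ sub (uncut C 0)) (nontrivial C 0)) }
        where
        bound : 2 * N ≤ N * (2 + cutCost h q)
        bound = ≤-trans (≤-reflexive (*-comm 2 N)) (*-monoʳ-≤ N (m≤m+n 2 (cutCost h q)))
      ... | P , P≤ , inj₂ r with later (Run.end r N)
      ...   | P₂ , P₂≤ , solve = P ++ P₂ , bound , grid
        where
        open Run r
        bound : length (P ++ P₂) ≤ N * (2 + cutCost h q)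
        bound = begin
          length (P ++ P₂)             ≡⟨ length-++ P ⟩
          length P + length P₂         ≤⟨ +-mono-≤ P≤ P₂≤ ⟩
          2 * N + N * cutCost h q      ≡⟨ cong (_+ N * cutCost h q) (*-comm 2 N) ⟩
          N * 2 + N * cutCost h q      ≡⟨ *-distribˡ-+ N 2 (cutCost h q) ⟨
          N * (2 + cutCost h q)        ∎
          where open ≤-Reasoning
        grid : Branch q s (P ++ P₂) S
        grid {P′} sub C refl = record
          { E = λ { zero → end ; (suc r) → G.E r }
          ; E-mono = λ { zero → end-mono ; (suc r) → G.E-mono r }
          ; E-level = λ { zero → G.E-start ; (suc r) → G.E-level r }
          ; E-start = ≤-reflexive (sym end-zero)
          ; E-holds = λ { zero i _ i<N → holds i i<N ; (suc r) i (s≤s r<q) i<N → G.E-holds r i r<q i<N }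
          }
          where
          later-grid : Grid q (end N) (λ r A → Hold A (set C (suc r)))
          later-grid = solve (tail C (λ c∈ → sub (∈-++⁺ʳ P c∈))
            (beyond (start-≥ C) (uncut-⊆ (λ c∈ → sub (∈-++⁺ˡ c∈)) (uncut C 0)) (nontrivial C 0) (held C 0)))
          module G = Grid later-grid

    -- The list `P` is fixed before the chain `C` is given, as the deletion requires. Only the first
    -- set of `C` selects a branch; the branch fixes where the scan continues, and the tail of `C`
    -- starts no earlier.
    chain-cuts : ∀ q s → Σ (List ℕ) λ P → length P ≤ N * cutCost h q ×
      ((C : Chain P s) → Grid q s (λ r A → Hold A (set C r)))
    chain-cuts zero s = [] , z≤n , λ C → record
      { E = λ _ _ → s ; E-mono = λ _ _ → ≤-refl ; E-level = λ _ → ≤-refl ; E-start = ≤-refl ; E-holds = λ _ _ () }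
    chain-cuts (suc q) s with gather {Q = Branch q s} (branch q (chain-cuts q) s) (subsets h)
    ... | P , P≤ , found = P , ≤-trans P≤ (≤-reflexive (rearrange (length (subsets h)) N (2 + cutCost h q))) ,
      λ C → let P′ , sub , solve = found (set∈ C 0) in solve sub C refl
      where
      rearrange : ∀ a b c → a * (b * c) ≡ b * (a * c)
      rearrange = solve-∀

-- Pigeonhole for slopes and offsets

length-concatMap-≤ : {A B : Set} (f : A → List B) {w : ℕ} → (∀ x → length (f x) ≤ w) →
  ∀ xs → length (concatMap f xs) ≤ length xs * w
length-concatMap-≤ f le []       = z≤n
length-concatMap-≤ f le (x ∷ xs) = ≤-trans (≤-reflexive (length-++ (f x))) (+-mono-≤ (le x) (length-concatMap-≤ f le xs))

injective-grid-≤ : {A : Set} {C k : ℕ} (f : Fin C → Fin k → A) (L : List A) → (∀ c j → f c j ∈ L) →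
  (∀ c j c′ j′ → f c j ≡ f c′ j′ → c ≡ c′ × j ≡ j′) → C * k ≤ length L
injective-grid-≤ {C = C} {k} f L mem inj = Finₚ.injective⇒≤ {f = λ p → spot (remQuot k p)}
  (λ {p} {q} eq → trans (sym (Finₚ.combine-remQuot {C} k p))
    (trans (cong (λ (c , j) → combine c j) (spot-injective (remQuot k p) (remQuot k q) eq)) (Finₚ.combine-remQuot {C} k q)))
  where
  spot : Fin C × Fin k → Fin (length L)
  spot (c , j) = index (mem c j)
  spot-injective : ∀ p q → spot p ≡ spot q → p ≡ q
  spot-injective (c , j) (c′ , j′) eq
    with refl , refl ← inj c j c′ j′ (MemSetoid.index-injective (setoid _) (mem c j) (mem c′ j′) eq) = refl

-- If each of the `C` rows had fewer than `k` good entries among `2k`, each would have at least `k`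
-- bad ones, and these would give `C * k` distinct elements of `L`.
sparse-row : {A : Set} {C k : ℕ} {Bad : Fin C → Fin (k + k) → Set} (bad? : ∀ c i → Dec (Bad c i))
  (L : List A) (f : ∀ c i → Bad c i → A) → (∀ c i b → f c i b ∈ L) →
  (∀ c i c′ i′ b b′ → f c i b ≡ f c′ i′ b′ → c ≡ c′ × i ≡ i′) → length L < C * k →
  Σ (Fin C) λ c → k ≤ # (λ i → not (does (bad? c i)))
sparse-row {C = C} {k} {Bad} bad? L f mem inj few with Finₚ.any? (λ c → k ≤? # (λ i → not (does (bad? c i))))
... | yes found = found
... | no none = contradiction (injective-grid-≤ (λ c j → f c (pick c j) (isBad c j)) L (λ c j → mem c (pick c j) (isBad c j)) pick-inj) (<⇒≱ few)
  where
  bad≥ : ∀ c → k ≤ # (λ i → does (bad? c i))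
  bad≥ c with k ≤? # (λ i → does (bad? c i))
  ... | yes le = le
  ... | no ≰ = contradiction (+-mono-<-≤ (≰⇒> ≰) (<⇒≤ (≰⇒> (λ le → none (c , le)))))
    (≤⇒≯ (≤-trans (≤-reflexive (sym (#-all {k + k}))) (#-split (λ _ → true) (λ i → does (bad? c i)))))
  chosen : ∀ c → Σ (Fin k → Fin (k + k)) λ g → (∀ i j → g i ≡ g j → i ≡ j) × (∀ i → does (bad? c (g i)) ≡ true)
  chosen c = inject-elems (λ i → does (bad? c i)) k (bad≥ c)
  pick : Fin C → Fin k → Fin (k + k)
  pick c = proj₁ (chosen c)
  isBad : ∀ c j → Bad c (pick c j)
  isBad c j = does-true (bad? c (pick c j)) (proj₂ (proj₂ (chosen c)) j)
  pick-inj : ∀ c j c′ j′ → f c (pick c j) (isBad c j) ≡ f c′ (pick c′ j′) (isBad c′ j′) → c ≡ c′ × j ≡ j′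
  pick-inj c j c′ j′ eq with inj c (pick c j) c′ (pick c′ j′) (isBad c j) (isBad c′ j′) eq
  ... | refl , i≡ = refl , proj₁ (proj₂ (chosen c)) j j′ i≡

-- Assembling copies along transversals

module Assembly {n h : ℕ} {T : Digraph n} (tour : Tournament T) (ord : Ordering T) (H : Digraph h)
  (rank : Fin h → ℕ) (rank<h : ∀ u → rank u < h) (rank-arc : ∀ u v → Arc H u v → rank u ≤ rank v)
  (N : ℕ) where

  open Ordering ord
  open Cut tour ord
  open Intervals ord H
  open Levels N

  level : ℕ → Fin h → Bool
  level r u = does (rank u ≟ r)

  module _ (grid : Grid h 0 (λ r A → Hold A (level r))) where
    open Grid grid

    E-mono-≤ : ∀ r {i j} → i ≤ j → E r i ≤ E r j
    E-mono-≤ r {i} {j} i≤j = subst (λ j → E r i ≤ E r j) (m∸n+n≡m i≤j) (go (j ∸ i))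
      where
      go : ∀ d → E r i ≤ E r (d + i)
      go zero    = ≤-refl
      go (suc d) = ≤-trans (go d) (E-mono r (d + i))

    E-level-< : ∀ {r r′} → r < r′ → E r N ≤ E r′ 0
    E-level-< {r} {suc r′} (s≤s r≤r′) with m≤n⇒m<n∨m≡n r≤r′
    ... | inj₂ refl = E-level r
    ... | inj₁ r<r′ = ≤-trans (E-level-< r<r′) (≤-trans (E-mono-≤ r′ z≤n) (E-level r′))

    cell : ℕ → ℕ → Fin n → Bool
    cell r a = interval (E r a) (E r (suc a))

    cell⁻ : ∀ {r a x} → cell r a x ≡ true → E r a ≤ pos x × pos x < E r (suc a)
    cell⁻ {r} {a} = interval⁻ {E r a} {E r (suc a)}

    cell-below : ∀ {r a x} → a < N → cell r a x ≡ true → pos x < E r N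
    cell-below {r} {a} a<N p = <-≤-trans (proj₂ (cell⁻ {r} {a} p)) (E-mono-≤ r a<N)

    cell-above : ∀ {r r′ a x} → r < r′ → cell r′ a x ≡ true → E r N ≤ pos x
    cell-above {r′ = r′} {a} r<r′ p = ≤-trans (E-level-< r<r′) (≤-trans (E-mono-≤ r′ z≤n) (proj₁ (cell⁻ {r′} {a} p)))

    cell-unique : ∀ {r r′ a a′ x} → a < N → a′ < N → cell r a x ≡ true → cell r′ a′ x ≡ true → r ≡ r′ × a ≡ a′
    cell-unique {r} {r′} {a} {a′} a<N a′<N p p′ with <-cmp r r′
    ... | tri< r<r′ _ _ = contradiction (cell-above r<r′ p′) (<⇒≱ (cell-below a<N p))
    ... | tri> _ _ r′<r = contradiction (cell-above r′<r p) (<⇒≱ (cell-below a′<N p′))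
    ... | tri≈ _ refl _ with <-cmp a a′
    ...   | tri≈ _ eq _ = refl , eq
    ...   | tri< a<a′ _ _ = contradiction (≤-trans (E-mono-≤ r a<a′) (proj₁ (cell⁻ {r} {a′} p′))) (<⇒≱ (proj₂ (cell⁻ {r} {a} p)))
    ...   | tri> _ _ a′<a = contradiction (≤-trans (E-mono-≤ r a′<a) (proj₁ (cell⁻ {r} {a} p))) (<⇒≱ (proj₂ (cell⁻ {r} {a′} p′)))

    module Packing (k C width : ℕ) (small : ∀ c → length (cutArcs c) ≤ width)
      (N≥ : k + k + C * h ≤ N) (enough : h * width < C * k) where

      -- The transversal of slope c and offset i uses the cell with index slot c i r at level r.
      slot : ℕ → ℕ → ℕ → ℕ
      slot c i r = i + c * r

      slot<N : ∀ {c i r} → c < C → i < k + k → r < h → slot c i r < N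
      slot<N c<C i<2k r<h = <-≤-trans (+-mono-<-≤ i<2k (*-mono-≤ (<⇒≤ c<C) (<⇒≤ r<h))) N≥

      Clash : ℕ → ℕ → Fin h → Fin h → Fin n → Fin n → Set
      Clash c i r r′ y x = toℕ r < toℕ r′ × Arc T y x ×
        cell (toℕ r) (slot c i (toℕ r)) x ≡ true × cell (toℕ r′) (slot c i (toℕ r′)) y ≡ true

      Bad : ℕ → ℕ → Set
      Bad c i = Σ (Fin h) λ r → Σ (Fin h) λ r′ → Σ (Fin n) λ y → Σ (Fin n) λ x → Clash c i r r′ y x

      bad? : ∀ c i → Dec (Bad c i)
      bad? c i = Finₚ.any? λ r → Finₚ.any? λ r′ → Finₚ.any? λ y → Finₚ.any? λ x →
        (toℕ r <? toℕ r′) ×-dec (T y x Boolₚ.≟ true) ×-dec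
        (cell (toℕ r) (slot c i (toℕ r)) x Boolₚ.≟ true) ×-dec (cell (toℕ r′) (slot c i (toℕ r′)) y Boolₚ.≟ true)

      -- An arc from a later level back to level `r` crosses the cut at the end `E r N` of level
      -- `r`, so `h` cuts catch all clashes.
      levelArcs : List (Fin n × Fin n)
      levelArcs = concatMap (λ r → cutArcs (E (toℕ r) N)) (allFin h)

      levelArcs-length : length levelArcs ≤ h * width
      levelArcs-length = ≤-trans (length-concatMap-≤ _ (λ r → small (E (toℕ r) N)) (allFin h))
        (≤-reflexive (cong (_* width) (length-tabulate {n = h} id)))

      clashArc : ∀ {c i} → Bad c i → Fin n × Fin n
      clashArc (_ , _ , y , x , _) = y , x

      clashArc∈ : ∀ {c i} → c < C → i < k + k → (b : Bad c i) → clashArc {c} {i} b ∈ levelArcs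
      clashArc∈ c<C i<2k (r , r′ , y , x , r<r′ , yx , px , py) =
        ∈-concatMap⁺ (λ r → cutArcs (E (toℕ r) N)) {xs = allFin h}
          (Any.map (λ { refl → backward⁺ yx (cell-below (slot<N c<C i<2k (Finₚ.toℕ<n r)) px) (cell-above r<r′ py) }) (∈-allFin r))

      -- Two cells at different levels determine the slope and the offset.
      clashArc-injective : ∀ {c i c′ i′} → c < C → i < k + k → c′ < C → i′ < k + k →
        (b : Bad c i) (b′ : Bad c′ i′) → clashArc {c} {i} b ≡ clashArc {c′} {i′} b′ → c ≡ c′ × i ≡ i′
      clashArc-injective {c} {i} {c′} {i′} c<C i<2k c′<C i′<2k
        (r₁ , r₂ , y , x , r₁<r₂ , _ , px , py) (r₁′ , r₂′ , .y , .x , _ , _ , px′ , py′) refl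
        with cell-unique (slot<N c<C i<2k (Finₚ.toℕ<n r₁)) (slot<N c′<C i′<2k (Finₚ.toℕ<n r₁′)) px px′
           | cell-unique (slot<N c<C i<2k (Finₚ.toℕ<n r₂)) (slot<N c′<C i′<2k (Finₚ.toℕ<n r₂′)) py py′
      ... | e₁ , s₁ | e₂ , s₂ = lines (toℕ r₁) (toℕ r₂) r₁<r₂
          (trans s₁ (cong (slot c′ i′) (sym e₁))) (trans s₂ (cong (slot c′ i′) (sym e₂)))
        where
        lines : ∀ r s → r < s → slot c i r ≡ slot c′ i′ r → slot c i s ≡ slot c′ i′ s → c ≡ c′ × i ≡ i′
        lines r s r<s eqr eqs with m≤n⇒∃[o]m+o≡n r<s
        ... | d , refl = c≡c′ , +-cancelʳ-≡ (c * r) i i′ (trans eqr (cong (λ c → i′ + c * r) (sym c≡c′)))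
          where
          expand : ∀ i c r d → i + c * (suc r + d) ≡ (i + c * r) + c * suc d
          expand = solve-∀
          c≡c′ : c ≡ c′
          c≡c′ = *-cancelʳ-≡ c c′ (suc d) (+-cancelˡ-≡ (i + c * r) _ _
            (trans (sym (expand i c r d)) (trans eqs (trans (expand i′ c′ r d) (cong (_+ c′ * suc d) (sym eqr))))))

      good : Fin C → Fin (k + k) → Bool
      good c i = not (does (bad? (toℕ c) (toℕ i)))

      goodSlope : Σ (Fin C) λ c → k ≤ # (good c)
      goodSlope = sparse-row (λ c i → bad? (toℕ c) (toℕ i)) levelArcs (λ c i → clashArc {toℕ c} {toℕ i}) (λ c i b → clashArc∈ {toℕ c} {toℕ i} (Finₚ.toℕ<n c) (Finₚ.toℕ<n i) b)
        (λ c i c′ i′ b b′ eq → let c≡ , i≡ = clashArc-injective {toℕ c} {toℕ i} {toℕ c′} {toℕ i′} (Finₚ.toℕ<n c) (Finₚ.toℕ<n i) (Finₚ.toℕ<n c′) (Finₚ.toℕ<n i′) b b′ eq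
           in Finₚ.toℕ-injective c≡ , Finₚ.toℕ-injective i≡)
        (≤-<-trans levelArcs-length enough)

      module Copy {c i : ℕ} (c<C : c < C) (i<2k : i < k + k) (isGood : ¬ Bad c i) where

        area : ℕ → Fin n → Bool
        area r = cell r (slot c i r)

        piece : ∀ r → r < h → Hold (area r) (level r)
        piece r r<h = E-holds r (slot c i r) r<h (slot<N c<C i<2k r<h)

        branch : Fin h → Fin n
        branch u = ψ (piece (rank u) (rank<h u)) u

        in-level : ∀ u → level (rank u) u ≡ true
        in-level u = dec-true (rank u ≟ rank u) refl

        branch∈ : ∀ u → area (rank u) (branch u) ≡ true
        branch∈ u = ψ∈ (piece (rank u) (rank<h u)) u (in-level u)

        area-unique : ∀ {r r′ x} → r < h → r′ < h → area r x ≡ true → area r′ x ≡ true → r ≡ r′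
        area-unique r<h r′<h p p′ = proj₁ (cell-unique (slot<N c<C i<2k r<h) (slot<N c<C i<2k r′<h) p p′)

        ψ-level : ∀ {r r′} (p : r < h) (p′ : r′ < h) → r ≡ r′ → ∀ v → ψ (piece r p) v ≡ ψ (piece r′ p′) v
        ψ-level p p′ refl v = cong (λ p → ψ (piece _ p) v) (<-irrelevant p p′)

        branch-injective : ∀ u v → branch u ≡ branch v → u ≡ v
        branch-injective u v eq = ψ-inj (piece (rank u) (rank<h u)) u v (in-level u)
          (dec-true (rank v ≟ rank u) (sym same)) (trans eq (ψ-level (rank<h v) (rank<h u) (sym same) v))
          where
          same : rank u ≡ rank v
          same = area-unique (rank<h u) (rank<h v) (branch∈ u) (subst (λ x → area (rank v) x ≡ true) (sym eq) (branch∈ v))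

        -- The vertices lie in different cells and so are distinct, and the opposite arc would be a
        -- clash on this transversal.
        forward : ∀ {u v} → rank u < rank v → Arc T (branch u) (branch v)
        forward {u} {v} lt = arc-total tour
          (λ eq → <-irrefl (area-unique (rank<h u) (rank<h v) (branch∈ u) (subst (λ x → area (rank v) x ≡ true) eq (branch∈ v))) lt)
          (λ vu → isGood (fromℕ< (rank<h u) , fromℕ< (rank<h v) , branch v , branch u ,
            subst₂ _<_ (sym eqᵘ) (sym eqᵛ) lt , vu ,
            subst (λ r → area r (branch u) ≡ true) (sym eqᵘ) (branch∈ u) ,
            subst (λ r → area r (branch v) ≡ true) (sym eqᵛ) (branch∈ v)))
          where
          eqᵘ = Finₚ.toℕ-fromℕ< (rank<h u)
          eqᵛ = Finₚ.toℕ-fromℕ< (rank<h v)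

        -- Two kinds of links: a single forward arc between levels, or a link of the piece at the
        -- common level.
        Shape : ∀ u v → Walk T (branch u) (branch v) → Set
        Shape u v w = (rank u < rank v × arcs w ≡ (branch u , branch v) ∷ [])
          ⊎ (rank u ≡ rank v × Σ (Arc (H ↾ level (rank u)) u v) λ a → arcs w ≡ arcs (link (piece (rank u) (rank<h u)) u v a))

        walk : ∀ u v → Arc H u v → Σ (Walk T (branch u) (branch v)) (Shape u v)
        walk u v a with <-cmp (rank u) (rank v)
        ... | tri< lt _ _ = step (forward {u} {v} lt) stop , inj₁ (lt , refl)
        ... | tri> _ _ gt = contradiction (rank-arc u v a) (<⇒≱ gt)
        ... | tri≈ _ eq _ = castWalk refl eqψ w , inj₂ (eq , a′ , trans (arcs-castWalk refl eqψ w) (arcs-mapWalk inT _))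
          where
          a′ = ↾⁺ {G = H} (level (rank u)) a (in-level u) (dec-true (rank v ≟ rank u) (sym eq))
          eqψ = ψ-level (rank<h u) (rank<h v) eq v
          inT : ∀ x y → Arc (T ↾ area (rank u)) x y → Arc T x y
          inT x y = ∧-fst {T x y}
          w = mapWalk inT (link (piece (rank u) (rank<h u)) u v a′)

        walk-located : ∀ {u v w e} → Shape u v w → e ∈ arcs w →
          area (rank u) (proj₁ e) ≡ true × area (rank v) (proj₂ e) ≡ true
        walk-located {u} {v} {e = e} (inj₁ (_ , eq)) e∈ with subst (e ∈_) eq e∈
        ... | here refl = branch∈ u , branch∈ v
        walk-located {u} {v} {e = e} (inj₂ (same , a , eq)) e∈
          with ↾⁻ {G = T} (area (rank u)) {proj₁ e} (arcs-are-arcs (link (piece (rank u) (rank<h u)) u v a) (subst (e ∈_) eq e∈))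
        ... | _ , p , q = p , subst (λ r → area r (proj₂ e) ≡ true) same q

        link-level-disjoint : ∀ {r r′} (p : r < h) (p′ : r′ < h) → r ≡ r′ → ∀ {u v u′ v′} a a′ → (u , v) ≢ (u′ , v′) →
          ∀ {e} → e ∈ arcs (link (piece r p) u v a) → e ∉ arcs (link (piece r′ p′) u′ v′ a′)
        link-level-disjoint p p′ refl a a′ ne with <-irrelevant p p′
        ... | refl = link-disjoint (piece _ p) _ _ a _ _ a′ ne

        -- The cells of the ends of a common arc reveal the levels of both labels, so the walks are
        -- of the same kind. Links at one level are disjoint within the piece, and equal forward
        -- arcs have equal labels.
        walk-disjoint : ∀ {u v u′ v′ w w′} → Shape u v w → Shape u′ v′ w′ → (u , v) ≢ (u′ , v′) →
          ∀ {e} → e ∈ arcs w → e ∉ arcs w′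
        walk-disjoint {u} {v} {u′} {v′} {w} {w′} S S′ ne {e} e∈ e∈′
          with walk-located {w = w} S e∈ | walk-located {w = w′} S′ e∈′
        ... | p , q | p′ , q′
          with area-unique (rank<h u) (rank<h u′) p p′ | area-unique (rank<h v) (rank<h v′) q q′
        ...   | ru | rv with S | S′
        ...     | inj₁ (lt , _) | inj₂ (eq , _) = <-irrefl (trans ru (trans eq (sym rv))) lt
        ...     | inj₂ (eq , _) | inj₁ (lt , _) = <-irrefl (trans (sym ru) (trans eq rv)) lt
        ...     | inj₂ (_ , a , eq) | inj₂ (_ , a′ , eq′) =
          link-level-disjoint (rank<h u) (rank<h u′) ru a a′ ne (subst (e ∈_) eq e∈) (subst (e ∈_) eq′ e∈′)
        ...     | inj₁ (_ , eq) | inj₁ (_ , eq′) with subst (e ∈_) eq e∈ | subst (e ∈_) eq′ e∈′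
        ...       | here refl | here both = ne (cong₂ _,_ (branch-injective u u′ (cong proj₁ both)) (branch-injective v v′ (cong proj₂ both)))

        copy : Piece T H full full
        copy = record
          { ψ = branch ; ψ∈ = λ _ _ → refl ; ψ-inj = λ u v _ _ → branch-injective u v
          ; link = λ u v a → proj₁ (walk u v (∧-fst a))
          ; link-disjoint = λ u v a u′ v′ a′ → walk-disjoint
              {w = proj₁ (walk u v (∧-fst a))} {w′ = proj₁ (walk u′ v′ (∧-fst a′))}
              (proj₂ (walk u v (∧-fst a))) (proj₂ (walk u′ v′ (∧-fst a′)))
          }

        copy-tail : ∀ {e} → UsesArc (fromPiece copy) e → Σ ℕ λ r → r < h × area r (proj₁ e) ≡ true
        copy-tail ue with fromPiece-uses copy ue
        ... | u , v , a , e∈ = rank u , rank<h u ,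
          proj₁ (walk-located {w = proj₁ (walk u v (∧-fst a))} (proj₂ (walk u v (∧-fst a))) e∈)

      -- All copies use one slope, so the cell containing the tail of an arc determines the offset
      -- and thereby the copy.
      packing : DisjointImmersions k T H
      packing with goodSlope
      ... | c , k≤ with inject-elems (good c) k k≤
      ...   | f , f-inj , f-good = (λ j → fromPiece (K.copy j)) , disjoint
        where
        module K (j : Fin k) = Copy {toℕ c} {toℕ (f j)} (Finₚ.toℕ<n c) (Finₚ.toℕ<n (f j)) (does-not (bad? (toℕ c) (toℕ (f j))) (f-good j))
        disjoint : ∀ j j′ → j ≢ j′ → ∀ e → UsesArc (fromPiece (K.copy j)) e → ¬ UsesArc (fromPiece (K.copy j′)) e
        disjoint j j′ j≢j′ e ue ue′ with K.copy-tail j ue | K.copy-tail j′ ue′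
        ... | r , r<h , p | r′ , r′<h , p′
          with cell-unique (slot<N {toℕ c} {toℕ (f j)} (Finₚ.toℕ<n c) (Finₚ.toℕ<n (f j)) r<h)
                 (slot<N {toℕ c} {toℕ (f j′)} (Finₚ.toℕ<n c) (Finₚ.toℕ<n (f j′)) r′<h) p p′
        ...   | refl , s≡ = j≢j′ (f-inj j j′ (Finₚ.toℕ-injective (+-cancelʳ-≡ (toℕ c * r) _ _ s≡)))

-- Deleting arcs

_∩_ : ∀ {n} → Digraph n → Digraph n → Digraph n
(G ∩ K) x y = G x y ∧ K x y

restrictWalk : ∀ {n} {G : Digraph n} (K : Digraph n) {x y} (w : Walk G x y) →
  (∀ {e} → e ∈ arcs w → Arc K (proj₁ e) (proj₂ e)) → Σ (Walk (G ∩ K) x y) λ w′ → arcs w′ ≡ arcs w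
restrictWalk K stop       ok = stop , refl
restrictWalk K (step a w) ok with restrictWalk K w (ok ∘ there)
... | w′ , eq = step (∧-intro a (ok (here refl))) w′ , cong (_ ∷_) eq

-- `K` tells which arcs stay. If no copy survives, the removed arcs hit every copy `M`: the arc is
-- found by searching the routes, and a route system without a removed arc would survive in `T ∩ K`.
hit-or-miss : ∀ {n h} (T : Digraph n) (H : Digraph h) (K : Digraph n) (b : ℕ) →
  length (arcsWhere (T ∩ (λ x y → not (K x y)))) ≤ b → Immersion (T ∩ K) H ⊎ SmallHittingSet b T H
hit-or-miss {n} {h} T H K b F≤ with piece? (T ∩ K) H full full
... | yes p = inj₁ (fromPiece p)
... | no none = inj₂ (F , arcsWhere-unique _ , All.tabulate (λ e∈ → ∧-fst (∈-arcsWhere⁻ removed e∈)) , F≤ , hit)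
  where
  removed : Digraph n
  removed = T ∩ (λ x y → not (K x y))
  F = arcsWhere removed
  module _ (M : Immersion T H) where
    HitBy : ∀ u v → Arc H u v → Set
    HitBy u v a = Any.Any (λ e → not (K (proj₁ e) (proj₂ e)) ≡ true) (arcs (route M u v a))
    hitBy? : ∀ u v → Dec (Σ (Arc H u v) (HitBy u v))
    hitBy? u v with H u v Boolₚ.≟ true
    ... | no ¬a = no (¬a ∘ proj₁)
    ... | yes a = map′ (a ,_) (λ (a′ , p) → subst (HitBy u v) (uip a′ a) p)
      (Any.any? (λ e → not (K (proj₁ e) (proj₂ e)) Boolₚ.≟ true) (arcs (route M u v a)))
    hit : Σ _ λ e → e ∈ F × UsesArc M e
    hit with Finₚ.any? (λ u → Finₚ.any? (λ v → hitBy? u v))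
    ... | yes (u , v , a , p) = let e , e∈ , out = find p in
      e , ∈-arcsWhere⁺ removed (∧-intro (arcs-are-arcs (route M u v a) e∈) out) , u , v , a , e∈
    ... | no clean = contradiction kept none
      where
      stays : ∀ u v a {e} → e ∈ arcs (route M u v a) → Arc K (proj₁ e) (proj₂ e)
      stays u v a {e} e∈ with K (proj₁ e) (proj₂ e) in eq
      ... | true  = refl
      ... | false = contradiction (u , v , a , lose e∈ (cong not eq)) clean
      kept : Piece (T ∩ K) H full full
      kept = record
        { ψ = φ M ; ψ∈ = λ _ _ → refl ; ψ-inj = λ u v _ _ → φ-inj M u v
        ; link = λ u v a → proj₁ (restrictWalk K (route M u v (∧-fst a)) (stays u v (∧-fst a)))
        ; link-disjoint = λ u v a u′ v′ a′ ne e∈ e∈′ → route-disjoint M u v (∧-fst a) u′ v′ (∧-fst a′) ne _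
            (subst (_ ∈_) (proj₂ (restrictWalk K (route M u v (∧-fst a)) (stays u v (∧-fst a)))) e∈)
            (subst (_ ∈_) (proj₂ (restrictWalk K (route M u′ v′ (∧-fst a′)) (stays u′ v′ (∧-fst a′)))) e∈′)
        }

-- A copy that survives the deletion of all arcs uses no arc, so `k` repetitions of it are
-- arc-disjoint.
all-arcs-hit : ∀ {n h} (T : Digraph n) (H : Digraph h) (k b : ℕ) → n * n ≤ b →
  DisjointImmersions k T H ⊎ SmallHittingSet b T H
all-arcs-hit {n} T H k b n²≤ with hit-or-miss T H (λ _ _ → false) b
    (≤-trans (length-filter _ (pairs n)) (≤-trans (≤-reflexive
      (trans (length-cartesianProduct (allFin n) (allFin n)) (cong₂ _*_ (length-tabulate {n = n} id) (length-tabulate {n = n} id)))) n²≤))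
... | inj₂ small = inj₂ small
... | inj₁ M = inj₁ ((λ _ → fromPiece P) , λ _ _ _ e used → contradiction used (unused e))
  where
  empty⊆ : ∀ x y → Arc (T ∩ (λ _ _ → false)) x y → Arc T x y
  empty⊆ x y = ∧-fst {T x y}
  P : Piece T H full full
  P = piece-mono empty⊆ (λ _ → id) (λ _ → id) (toPiece M)
  unused : ∀ e → ¬ UsesArc (fromPiece P) e
  unused e used with fromPiece-uses P used
  ... | u , v , a , e∈ = contradiction (no-arcs (link (toPiece M) u v _) e∈) λ ()
    where
    no-arcs : ∀ {x y} (w : Walk (T ∩ (λ _ _ → false)) x y) → e ∈ arcs (mapWalk {G′ = T} empty⊆ w) → false ≡ true
    no-arcs w e∈ = ∧-snd {T (proj₁ e) (proj₂ e)} (arcs-are-arcs w (subst (e ∈_) (arcs-mapWalk empty⊆ w) e∈))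

-- Blocks of a cut sequence

-- The first position of the block of `x`, which also names the block. The default 0 is the start of
-- the block before all positive cuts.
lastCut : List ℕ → ℕ → ℕ
lastCut []      x = 0
lastCut (c ∷ P) x with c ≤? x
... | yes _ = c ⊔ lastCut P x
... | no _  = lastCut P x

lastCut-≤ : ∀ P x → lastCut P x ≤ x
lastCut-≤ []      x = z≤n
lastCut-≤ (c ∷ P) x with c ≤? x
... | yes c≤x = ⊔-lub c≤x (lastCut-≤ P x)
... | no _    = lastCut-≤ P x

≤-lastCut : ∀ {P c x} → c ∈ P → c ≤ x → c ≤ lastCut P x
≤-lastCut {c ∷ P} {x = x} (here refl) c≤x with c ≤? x
... | yes _ = m≤m⊔n c (lastCut P x)
... | no ≰  = contradiction c≤x ≰
≤-lastCut {d ∷ P} {x = x} (there c∈) c≤x with d ≤? x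
... | yes _ = ≤-trans (≤-lastCut c∈ c≤x) (m≤n⊔m d (lastCut P x))
... | no _  = ≤-lastCut c∈ c≤x

lastCut-∈ : ∀ P x → lastCut P x ≡ 0 ⊎ lastCut P x ∈ P
lastCut-∈ []      x = inj₁ refl
lastCut-∈ (c ∷ P) x with c ≤? x
... | no _ = Sum.map₂ there (lastCut-∈ P x)
... | yes _ with ⊔-sel c (lastCut P x)
...   | inj₁ eq = inj₂ (here eq)
...   | inj₂ eq rewrite eq = Sum.map₂ there (lastCut-∈ P x)

module Blocks {n h : ℕ} {T : Digraph n} (tour : Tournament T) (ord : Ordering T) (H : Digraph h)
  (simple : Simple H) (N : ℕ) where

  open Ordering ord
  open Cut tour ord
  open Intervals ord H
  open Levels N

  cuts : List ℕ
  cuts = proj₁ (chain-cuts h 0)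

  blockOf : Fin n → ℕ
  blockOf v = lastCut cuts (pos v)

  monotone : Digraph n
  monotone x y = does (blockOf x ≤? blockOf y)

  -- A removed arc from `x` into an earlier block crosses the cut at the start of the block of `x`.
  -- That start is a genuine cut, as no block precedes the default 0.
  removed-small : ∀ {width} → (∀ c → length (cutArcs c) ≤ width) →
    length (arcsWhere (T ∩ (λ x y → not (monotone x y)))) ≤ N * cutCost h h * width
  removed-small {width} small = begin
    length (arcsWhere (T ∩ (λ x y → not (monotone x y)))) ≤⟨ unique-⊆-length (arcsWhere-unique _) sub ⟩
    length (concatMap cutArcs cuts)                       ≤⟨ length-concatMap-≤ cutArcs small cuts ⟩
    length cuts * width                                   ≤⟨ *-monoˡ-≤ width (proj₁ (proj₂ (chain-cuts h 0))) ⟩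
    N * cutCost h h * width                               ∎
    where
    open ≤-Reasoning
    sub : ∀ {e} → e ∈ arcsWhere (T ∩ (λ x y → not (monotone x y))) → e ∈ concatMap cutArcs cuts
    sub {x , y} e∈ = ∈-concatMap⁺ cutArcs {xs = cuts} (Any.map (λ eq → subst (λ c → (x , y) ∈ cutArcs c) eq crosses) cut∈)
      where
      p = ∈-arcsWhere⁻ (T ∩ (λ x y → not (monotone x y))) e∈
      y<x : blockOf y < blockOf x
      y<x = ≰⇒> (does-not (blockOf x ≤? blockOf y) (∧-snd {T x y} p))
      cut∈ : blockOf x ∈ cuts
      cut∈ with lastCut-∈ cuts (pos x)
      ... | inj₂ c∈ = c∈
      ... | inj₁ eq = contradiction (subst (blockOf y <_) eq y<x) λ ()
      crosses : (x , y) ∈ cutArcs (blockOf x)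
      crosses = backward⁺ (∧-fst {T x y} p) (≰⇒> (λ le → <⇒≱ y<x (≤-lastCut cut∈ le))) (lastCut-≤ cuts (pos x))

  walk-monotone : ∀ {x y} → Walk (T ∩ monotone) x y → blockOf x ≤ blockOf y
  walk-monotone stop = ≤-refl
  walk-monotone (step {x} {y} a w) =
    ≤-trans (does-true (blockOf x ≤? blockOf y) (∧-snd {T x y} a)) (walk-monotone w)

  block : ℕ → Fin n → Bool
  block β v = does (blockOf v ≟ β)

  -- Blocks never decrease along the walk, so one that left the block could not return.
  walk-in-block : ∀ β {x y} (w : Walk (T ∩ monotone) x y) → blockOf x ≡ β → blockOf y ≡ β →
    Σ (Walk (T ↾ block β) x y) λ w′ → arcs w′ ≡ arcs w
  walk-in-block β stop _ _ = stop , refl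
  walk-in-block β (step {x} {y} {z} a w) ex ez with walk-in-block β w ey ez
    where
    ey : blockOf y ≡ β
    ey = ≤-antisym (≤-trans (walk-monotone w) (≤-reflexive ez))
      (≤-trans (≤-reflexive (sym ex)) (does-true (blockOf x ≤? blockOf y) (∧-snd {T x y} a)))
  ... | w′ , eq = step (↾⁺ {G = T} (block β) (∧-fst {T x y} a) (dec-true (blockOf x ≟ β) ex) (dec-true (blockOf y ≟ β) ey)) w′ , cong (_ ∷_) eq
    where
    ey : blockOf y ≡ β
    ey = ≤-antisym (≤-trans (walk-monotone w) (≤-reflexive ez))
      (≤-trans (≤-reflexive (sym ex)) (does-true (blockOf x ≤? blockOf y) (∧-snd {T x y} a)))

  block-uncut : ∀ β → Uncut cuts β (block β)
  block-uncut β v p with does-true (blockOf v ≟ β) p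
  ... | refl = lastCut-≤ cuts (pos v) , λ c∈ lt → ≰⇒> (λ le → <⇒≱ lt (≤-lastCut c∈ le))

  vertexPiece : ∀ {A S z} → A z ≡ true → (∀ u v → S u ≡ true → S v ≡ true → u ≡ v) → Hold A S
  vertexPiece {A} {S} {z} Az single = record
    { ψ = λ _ → z ; ψ∈ = λ _ _ → Az ; ψ-inj = λ u v Su Sv _ → single u v Su Sv
    ; link = λ u v a → ⊥-elim (none u v a)
    ; link-disjoint = λ u v a → ⊥-elim (none u v a)
    }
    where
    none : ∀ u v → ¬ Arc (H ↾ S) u v
    none u v a with ↾⁻ {G = H} S {u} {v} a
    ... | uv , Su , Sv with single u v Su Sv
    ...   | refl = simple u uv

  -- From a surviving copy to a packing

  module _ (M : Immersion (T ∩ monotone) H) (large : h * N ≤ n) where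

    key : Fin h → ℕ
    key u = blockOf (φ M u)

    open Rank key

    rank-arc : ∀ u v → Arc H u v → rank u ≤ rank v
    rank-arc u v a = rank-mono-≤ {u} {v} (walk-monotone (route M u v a))

    open Assembly tour ord H rank rank<n rank-arc N

    group : ℕ → Fin h → Bool
    group β u = does (key u ≟ β)

    groupPiece : ∀ β → Hold (block β) (group β)
    groupPiece β = record
      { ψ = φ M ; ψ∈ = λ u p → p ; ψ-inj = λ u v _ _ → φ-inj M u v
      ; link = λ u v a → proj₁ (inside u v a)
      ; link-disjoint = λ u v a u′ v′ a′ ne e∈ e∈′ → route-disjoint M u v (∧-fst a) u′ v′ (∧-fst a′) ne _
          (subst (_ ∈_) (proj₂ (inside u v a)) e∈) (subst (_ ∈_) (proj₂ (inside u′ v′ a′)) e∈′)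
      }
      where
      inside : ∀ u v (a : Arc (H ↾ group β) u v) →
        Σ (Walk (T ↾ block β) (φ M u) (φ M v)) λ w → arcs w ≡ arcs (route M u v (∧-fst a))
      inside u v a with ↾⁻ {G = H} (group β) {u} {v} a
      ... | _ , p , q = walk-in-block β (route M u v (∧-fst a)) (does-true (key u ≟ β) p) (does-true (key v ≟ β) q)

    Multi : Fin h → Set
    Multi u = Nontrivial (group (key u))

    multi? : ∀ u → Dec (Multi u)
    multi? u = Finₚ.any? λ x → Finₚ.any? λ y →
      ¬? (x Finₚ.≟ y) ×-dec (group (key u) x Boolₚ.≟ true) ×-dec (group (key u) y Boolₚ.≟ true)

    atLevel? : ∀ r → Dec (Σ (Fin h) λ u → rank u ≡ r × Multi u)
    atLevel? r = Finₚ.any? λ u → (rank u ≟ r) ×-dec multi? u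

    level-single : ∀ {r} → ¬ (Σ (Fin h) λ u → rank u ≡ r × Multi u) →
      ∀ u v → level r u ≡ true → level r v ≡ true → u ≡ v
    level-single {r} none u v p q with u Finₚ.≟ v
    ... | yes eq = eq
    ... | no u≢v = contradiction
      (u , does-true (rank u ≟ r) p , u , v , u≢v , dec-true (key u ≟ key u) refl ,
        dec-true (key v ≟ key u) (rank-cancel-≡ {v} {u} (trans (does-true (rank v ≟ r) q) (sym (does-true (rank u ≟ r) p)))))
      none

    -- All groups are singletons: any h * N consecutive vertices will do.
    singletonGrid : ¬ (Σ (Fin h) Multi) → Grid h 0 (λ r A → Hold A (level r))
    singletonGrid none = record
      { E = λ r i → r * N + i
      ; E-mono = λ r i → +-monoʳ-≤ (r * N) (n≤1+n i)
      ; E-level = λ r → ≤-reflexive (trans (+-comm (r * N) N) (sym (+-identityʳ _)))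
      ; E-start = z≤n
      ; E-holds = holds
      }
      where
      holds : ∀ r i → r < h → i < N → Hold (interval (r * N + i) (r * N + suc i)) (level r)
      holds r i r<h i<N with pos-surj {r * N + i} (<-≤-trans (+-monoʳ-< (r * N) i<N)
          (≤-trans (≤-reflexive (+-comm (r * N) N)) (≤-trans (*-monoˡ-≤ N r<h) large)))
      ... | z , eq = vertexPiece {z = z} (interval⁺ (≤-reflexive (sym eq)) (≤-reflexive (trans (cong suc eq) (sym (+-suc (r * N) i)))))
        (level-single (λ { (u , _ , mu) → none (u , mu) }))

    least : ∀ m u → Multi u → key u ≤ m → Σ (Fin h) λ u₀ → Multi u₀ × (∀ v → Multi v → key u₀ ≤ key v)
    least m u mu le with Finₚ.any? (λ v → multi? v ×-dec (key v <? key u))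
    ... | no none = u , mu , λ v mv → ≮⇒≥ (λ lt → none (v , mv , lt))
    least zero    u mu le | yes (v , mv , lt) = contradiction (<-≤-trans lt le) λ ()
    least (suc m) u mu le | yes (v , mv , lt) = least m v mv (≤-pred (<-≤-trans lt le))

    module _ (u₀ : Fin h) (multi₀ : Multi u₀) (least₀ : ∀ v → Multi v → key u₀ ≤ key v) where

      -- The most recent group with several vertices up to level r, or the first such group.
      Pending : ℕ → Set
      Pending r = Σ (Fin h) λ u → Multi u × (∀ v → Multi v → r ≤ rank v → key u ≤ key v)

      advance : ∀ r → Pending r → Pending (suc r)
      advance r (u , mu , below) with atLevel? r
      ... | no _ = u , mu , λ v mv lt → below v mv (<⇒≤ lt)
      ... | yes (u′ , refl , mu′) = u′ , mu′ , λ v _ lt → <⇒≤ (rank-cancel-< {u′} {v} lt)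

      pending : ∀ r → Pending r
      pending zero    = u₀ , multi₀ , λ v mv _ → least₀ v mv
      pending (suc r) = advance r (pending r)

      -- The index `suc r` means that level `r` has been taken into account: a group with several
      -- vertices at level `r` is its own current group.
      current : ℕ → ℕ
      current r = key (proj₁ (pending (suc r)))

      advance-at : ∀ r P u → rank u ≡ r → Multi u → key (proj₁ (advance r P)) ≡ key u
      advance-at r P u eq mu with atLevel? r
      ... | no none = contradiction (u , eq , mu) none
      ... | yes (u′ , refl , _) = rank-cancel-≡ {u′} {u} (sym eq)

      advance-mono : ∀ r (P : Pending r) → key (proj₁ P) ≤ key (proj₁ (advance r P))
      advance-mono r (u , mu , below) with atLevel? r
      ... | no _ = ≤-refl
      ... | yes (u′ , refl , mu′) = below u′ mu′ ≤-refl

      -- A chain requires its sets to occur in `subsets h`, so each group is replaced by its listed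
      -- double.
      canonical : ∀ r → Σ (Fin h → Bool) λ S → S ∈ subsets h × (∀ u → S u ≡ group (current r) u)
      canonical r = functions-complete (true ∷ false ∷ []) (λ { true → here refl ; false → there (here refl) }) h (group (current r))

      chainSet : ℕ → Fin h → Bool
      chainSet r = proj₁ (canonical r)

      toGroup : ∀ {r u} → chainSet r u ≡ true → group (current r) u ≡ true
      toGroup {r} {u} p = trans (sym (proj₂ (proj₂ (canonical r)) u)) p

      fromGroup : ∀ {r u} → group (current r) u ≡ true → chainSet r u ≡ true
      fromGroup {r} {u} p = trans (proj₂ (proj₂ (canonical r)) u) p

      chainSet-nontrivial : ∀ r → Nontrivial (chainSet r)
      chainSet-nontrivial r with proj₁ (proj₂ (pending (suc r)))
      ... | x , y , x≢y , p , q = x , y , x≢y , fromGroup {r} p , fromGroup {r} q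

      chain : Chain cuts 0
      chain = record
        { set = chainSet
        ; set∈ = λ r → proj₁ (proj₂ (canonical r))
        ; nontrivial = chainSet-nontrivial
        ; block = λ r → block (current r)
        ; start = current
        ; held = λ r → hold-mono (λ _ → id) (λ u → toGroup {r} {u}) (groupPiece (current r))
        ; uncut = λ r → block-uncut (current r)
        ; start-mono = λ r → advance-mono (suc r) (pending (suc r))
        ; start-≥ = z≤n
        }

      -- If level `r` has a group with several vertices, that group is the current one. Otherwise
      -- the level has at most one vertex, which may go to any vertex of `A`; the borrowed piece
      -- supplies one.
      toLevel : ∀ r {A} → Hold A (chainSet r) → Hold A (level r)
      toLevel r {A} p = go (atLevel? r)
        where
        go : Dec (Σ (Fin h) λ u → rank u ≡ r × Multi u) → Hold A (level r)
        go (yes (u , eq , mu)) = hold-mono {S = chainSet r} {S′ = level r} (λ _ → id) inSet p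
          where
          inSet : ∀ v → level r v ≡ true → chainSet r v ≡ true
          inSet v q = fromGroup {r} (dec-true (key v ≟ current r)
            (trans (rank-cancel-≡ {v} {u} (trans (does-true (rank v ≟ r) q) (sym eq))) (sym (advance-at r (pending r) u eq mu))))
        go (no none) = let x , _ , _ , Sx , _ = chainSet-nontrivial r in
          vertexPiece {z = ψ p x} (ψ∈ p x Sx) (level-single none)

      chainGrid : Grid h 0 (λ r A → Hold A (level r))
      chainGrid = record
        { E = E ; E-mono = E-mono ; E-level = E-level ; E-start = E-start
        ; E-holds = λ r i r<h i<N → toLevel r (E-holds r i r<h i<N) }
        where open Grid (proj₂ (proj₂ (chain-cuts h 0)) chain)

    levelGrid : Grid h 0 (λ r A → Hold A (level r))
    levelGrid with Finₚ.any? multi?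
    ... | no none = singletonGrid none
    ... | yes (u , mu) with least (key u) u mu ≤-refl
    ...   | u₀ , mu₀ , least₀ = chainGrid u₀ mu₀ least₀

    immersion⇒packing : ∀ k C width → (∀ c → length (cutArcs c) ≤ width) → k + k + C * h ≤ N → h * width < C * k →
      DisjointImmersions k T H
    immersion⇒packing k C width small N≥ enough = Packing.packing levelGrid k C width small N≥ enough

-- The six inequalities in order: budget of the greedy routing, size of a sparse cut, room for all
-- transversals, more lines than backward arcs can spoil, and the size of the hitting set for
-- `h * N ≤ n` and for smaller tournaments.
packing-or-hitting : ∀ {h} (H : Digraph h) → Simple H → ∀ k m C N width b →
  8 * (k * (h * h)) ≤ m → (21 * m + 18 + 2 * h) * (21 * m + 18 + 2 * h) ≤ width →
  k + k + C * h ≤ N → h * width < C * k → N * cutCost h h * width ≤ b → h * N * (h * N) ≤ b →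
  ∀ {n} (T : Digraph n) → Tournament T → DisjointImmersions k T H ⊎ SmallHittingSet b T H
packing-or-hitting {h} H simple k m C N width b m≥ width≥ N≥ enough b≥ b≥′ {n} T tour =
  split (Cut.cuts-small tour ord m h)
  where
  ord = outdegreeOrdering T
  open Cut tour ord using (cutArcs)
  open Blocks tour ord H simple N
  split : RobustFamily T m h ⊎ (∀ c → length (cutArcs c) ≤ (21 * m + 18 + 2 * h) * (21 * m + 18 + 2 * h)) →
    DisjointImmersions k T H ⊎ SmallHittingSet b T H
  split (inj₁ robust) = inj₁ (robust⇒packing T H k m m≥ robust)
  split (inj₂ small) with h * N ≤? n
  ... | no ≰n = all-arcs-hit T H k b (≤-trans (*-mono-≤ (<⇒≤ (≰⇒> ≰n)) (<⇒≤ (≰⇒> ≰n))) b≥′)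
  ... | yes hN≤n with hit-or-miss T H monotone b (≤-trans (removed-small (λ c → ≤-trans (small c) width≥)) b≥)
  ...   | inj₂ hit = inj₂ hit
  ...   | inj₁ M = inj₁ (immersion⇒packing M hN≤n k C width (λ c → ≤-trans (small c) width≥) N≥ enough)

-- Choice of the constants

module Bounds (h g κ : ℕ) where

  ν total : ℕ
  -- The 2 makes room for the `2k` offsets and the rest for `C` slopes over `h` levels. The summand
  -- 1 in `h * (κ * κ) + 1` makes `C * k` exceed `h * width` by `k * k`.
  ν = 2 + (h * (κ * κ) + 1) * h
  -- One summand for the arcs deleted across the cuts, one for deleting all arcs of a tournament
  -- with fewer than `h * N` vertices.
  total = ν * g * (κ * κ) + h * ν * (h * ν)

  module _ (k : ℕ) (1≤k : 1 ≤ k) where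
    open ≤-Reasoning

    width C N : ℕ
    width = κ * k * (κ * k)
    C = (h * (κ * κ) + 1) * k
    N = ν * k

    N≥ : k + k + C * h ≤ N
    N≥ = ≤-reflexive (rearrange k (h * (κ * κ) + 1) h)
      where
      rearrange : ∀ k a b → k + k + a * k * b ≡ (2 + a * b) * k
      rearrange = solve-∀

    enough : h * width < C * k
    enough = begin-strict
      h * width                     <⟨ m<m+n (h * width) (*-mono-≤ 1≤k 1≤k) ⟩
      h * width + k * k             ≡⟨ rearrange h κ k ⟩
      C * k                         ∎
      where
      rearrange : ∀ h κ k → h * (κ * k * (κ * k)) + k * k ≡ (h * (κ * κ) + 1) * k * k
      rearrange = solve-∀

    cut-bound : N * g * width ≤ total * k ^ 3
    cut-bound = begin
      N * g * width                              ≡⟨ rearrange ν k g κ ⟩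
      ν * g * (κ * κ) * k ^ 3                    ≤⟨ *-monoˡ-≤ (k ^ 3) (m≤m+n (ν * g * (κ * κ)) (h * ν * (h * ν))) ⟩
      total * k ^ 3                              ∎
      where
      rearrange : ∀ a k b c → a * k * b * (c * k * (c * k)) ≡ a * b * (c * c) * (k * (k * (k * 1)))
      rearrange = solve-∀

    small-bound : h * N * (h * N) ≤ total * k ^ 3
    small-bound = begin
      h * N * (h * N)                        ≡⟨ rearrange h ν k ⟩
      h * ν * (h * ν) * (k * (k * 1))        ≤⟨ *-monoʳ-≤ (h * ν * (h * ν)) (≤-trans (≤-reflexive (sym (*-identityˡ (k * (k * 1))))) (*-monoˡ-≤ (k * (k * 1)) 1≤k)) ⟩
      h * ν * (h * ν) * k ^ 3                ≤⟨ *-monoˡ-≤ (k ^ 3) (m≤n+m (h * ν * (h * ν)) (ν * g * (κ * κ))) ⟩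
      total * k ^ 3                          ∎
      where
      rearrange : ∀ a b k → a * (b * k) * (a * (b * k)) ≡ a * b * (a * b) * (k * (k * 1))
      rearrange = solve-∀

-- This is the number of heads or tails that forces a robust family at budget
-- `m = 8 * (k * (h * h))`, made linear in `k`; 168 is 21 times 8.
root-bound : ∀ h k → 1 ≤ k → 21 * (8 * (k * (h * h))) + 18 + 2 * h ≤ (168 * (h * h) + 18 + 2 * h) * k
root-bound h k 1≤k = begin
  21 * (8 * (k * (h * h))) + 18 + 2 * h    ≡⟨ cong₂ _+_ (cong₂ _+_ (assoc k (h * h)) (*-identityʳ 18)) (*-identityʳ (2 * h)) ⟨
  168 * (h * h) * k + 18 * 1 + 2 * h * 1   ≤⟨ +-mono-≤ (+-monoʳ-≤ (168 * (h * h) * k) (*-monoʳ-≤ 18 1≤k)) (*-monoʳ-≤ (2 * h) 1≤k) ⟩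
  168 * (h * h) * k + 18 * k + 2 * h * k   ≡⟨ distrib (168 * (h * h)) 18 (2 * h) k ⟨
  (168 * (h * h) + 18 + 2 * h) * k         ∎
  where
  open ≤-Reasoning
  assoc : ∀ k s → 168 * s * k ≡ 21 * (8 * (k * s))
  assoc = solve-∀
  distrib : ∀ a b c k → (a + b + c) * k ≡ a * k + b * k + c * k
  distrib = solve-∀

theorem5 : ∀ {h} (H : Digraph h) → Simple H →
    Σ ℕ λ c → ∀ (k : ℕ) → 1 ≤ k → ∀ {n} (T : Digraph n) → Tournament T →
    DisjointImmersions k T H ⊎ SmallHittingSet (c * k ^ 3) T H
theorem5 {h} H simple = B.total , λ k 1≤k →
  packing-or-hitting H simple k (8 * (k * (h * h))) (B.C k 1≤k) (B.N k 1≤k) (B.width k 1≤k) (B.total * k ^ 3) ≤-refl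
    (*-mono-≤ (root-bound h k 1≤k) (root-bound h k 1≤k)) (B.N≥ k 1≤k) (B.enough k 1≤k) (B.cut-bound k 1≤k) (B.small-bound k 1≤k)
  where module B = Bounds h (cutCost h h) (168 * (h * h) + 18 + 2 * h)
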